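{- For every integer $n\ge 1$ and all $u,w\in S_\infty$, the skew Schubert polynomial $$u^{ -1}\,\partial_u^w\bigl(\mathfrak{S}_{w_0(n)}(x)\bigr)$$ is a polynomial in the variables $x_i$ with nonnegative integer coefficients.
   Context: $\mathbb{N}=\{1,2,3,\dots\}$. $S_\infty$ is the group of bijections $\mathbb{N}\to\mathbb{N}$ fixing all but finitely many elements, with product $(uv)(i)=u(v(i))$ and identity $1$. $s_i$ ($i\ge 1$) is the transposition of $i$ and $i+1$. $\ell(u)$ is the number of pairs $i<j$ with $u(i)>u(j)$. $S_\infty$ acts on $\mathbb{Z}[x]=\mathbb{Z}[x_1,x_2,\dots]$ by ring automorphisms with $u(x_j)=x_{u(j)}$. The divided difference operators are $\partial^{s_i}(P)=\frac{P-s_i(P)}{x_i-x_{i+1}}$. $w_0(n)$ is the longest element of $S_{n+1}$ ($w_0(n)(i)=n+2-i$ for $i\le n+1$, and $w_0(n)(i)=i$ for $i>n+1$), and $\mathfrak{S}_{w_0(n)}(x)=\prod_{i=1}^{n}x_i^{\,n+1-i}$. The skew divided difference operators $\partial_u^w$ ($u,w\in S_\infty$), acting on polynomials in $x$, are characterized by the generalized Leibniz formula $\partial^w(PQ)=\sum_u\partial^u(P)\,\partial_u^w(Q)$, where $\partial^u=\partial^{s_{i_1}}\cdots\partial^{s_{i_m}}$ for any reduced word $u=s_{i_1}\cdots s_{i_m}$, $m=\ell(u)$. They satisfy, and are determined by, the following recurrence: $\partial_1^1=1$ (the identity operator); $\partial_u^1=0$ if $u\ne1$; and whenever $\ell(ws_i)<\ell(w)$,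 $$\partial_u^w=\partial_u^{ws_i}\partial^{s_i}+\partial_{us_i}^{ws_i}s_i\ \text{ if }\ell(us_i)<\ell(u),\qquad \partial_u^w=\partial_u^{ws_i}\partial^{s_i}\ \text{ if }\ell(us_i)>\ell(u),$$ where products of operators are compositions (rightmost applied first). The skew Schubert polynomials (in the sense of Kirillov) are the polynomials $u^{ -1}\partial_u^w(\mathfrak{S}_{w_0(n)}(x))$, i.e. the permutation $u^{ -1}$ applied to the variables of $\partial_u^w(\mathfrak{S}_{w_0(n)}(x))$. -}

module Defs where

open import Data.Bool.Base using (if_then_else_)
open import Data.Integer.Base as ℤ using (ℤ; 0ℤ; 1ℤ; -1ℤ; _+_; _-_; _*_; -_)
import Data.Integer.Properties as ℤ
open import Data.Integer.Tactic.RingSolver using (solve-∀)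
open import Data.List.Base using (List; []; _∷_; _++_; map; concatMap; foldr; filter; length; upTo; cartesianProduct; cartesianProductWith)
open import Data.List.Properties using (map-++; ++-identityʳ; length-map)
open import Data.List.Membership.DecPropositional using () renaming (_∈?_ to member?)
open import Data.List.Membership.Propositional using (_∈_)
open import Data.List.Membership.Propositional.Properties using (∈-∃++; ∈-filter⁺; ∈-filter⁻; ∈-cartesianProduct⁺; ∈-upTo⁺; ∈-map⁻)
open import Data.List.Relation.Binary.Permutation.Propositional using (_↭_; ↭-refl; ↭-sym; ↭-trans; prep; swap)
open import Data.List.Relation.Binary.Permutation.Propositional.Properties using (∈-resp-↭; drop-∷; shift; ↭-length)
open import Data.List.Relation.Unary.All as All using (All; []; _∷_)
open import Data.List.Relation.Unary.AllPairs using ([]; _∷_)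
open import Data.List.Relation.Unary.Any using (here; there)
open import Data.List.Relation.Unary.Unique.Propositional using (Unique)
import Data.List.Relation.Unary.Unique.Propositional.Properties as Unique
open import Data.Nat.Base as ℕ using (ℕ; zero; suc; _≤_; _<_; _⊔_; _∸_; z≤n; s≤s)
open import Data.Nat.Induction using (<-wellFounded)
import Data.Nat.Properties as ℕ
open import Data.Product.Base using (∃; _×_; _,_; proj₁; proj₂; map₁; map₂; zip)
open import Data.Sum.Base using (_⊎_; inj₁; inj₂; [_,_]′)
open import Function.Base using (_∘_; id; const)
open import Function.Bundles using (_↔_; mk↔ₛ′; module Inverse)
open import Function.Construct.Composition using (_↔-∘_)
open import Function.Construct.Identity using (↔-id)
open import Function.Construct.Symmetry using (↔-sym)
open import Induction.WellFounded using (Acc; acc)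
open import Relation.Binary.Definitions using (tri<; tri≈; tri>)
open import Relation.Binary.PropositionalEquality using (_≡_; _≢_; refl; sym; trans; cong; cong₂; subst; module ≡-Reasoning)
open import Relation.Nullary using (¬_; Dec; yes; no; does; contradiction)
open import Relation.Nullary.Decidable using (_×-dec_; map′)

infix  4 _≈_ _≈ₚ_ _↭?_
infixl 6 _+ₚ_ _-ₚ_
infixl 7 _*ₚ_
infixl 7 _∙_
infixr 8 _▷_ _^ₚ_
infix  9 _⁻¹

------------------------------------------------------------------------
-- Indices start at 0 instead of 1: the index i here is the index i + 1 of
-- the usual convention ℕ = {1, 2, …}, both for the points permuted and
-- for the variables.

record S∞ : Set where
  field
    perm  : ℕ ↔ ℕ
    bound : ℕ
    fixes : ∀ i → bound ≤ i → Inverse.to perm i ≡ i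

  open Inverse perm public using (to; from)

open S∞ public using (bound; fixes; to)

_≈_ : S∞ → S∞ → Set
u ≈ v = ∀ i → to u i ≡ to v i

𝟙 : S∞
𝟙 = record { perm = ↔-id ℕ ; bound = 0 ; fixes = λ _ _ → refl }

_∙_ : S∞ → S∞ → S∞
u ∙ v = record
  { perm  = S∞.perm u ↔-∘ S∞.perm v
  ; bound = bound u ⊔ bound v
  ; fixes = λ i ≤i → trans
      (cong (to u) (fixes v i (ℕ.m⊔n≤o⇒n≤o (bound u) (bound v) ≤i)))
      (fixes u i (ℕ.m⊔n≤o⇒m≤o (bound u) (bound v) ≤i))
  }

_⁻¹ : S∞ → S∞
u ⁻¹ = record
  { perm  = ↔-sym (S∞.perm u)
  ; bound = bound u
  ; fixes = λ i ≤i → Inverse.inverseʳ (S∞.perm u) (sym (fixes u i ≤i))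
  }

transposition : ℕ → ℕ → ℕ
transposition zero    zero          = 1
transposition zero    (suc zero)    = 0
transposition zero    (suc (suc j)) = suc (suc j)
transposition (suc i) zero          = zero
transposition (suc i) (suc j)       = suc (transposition i j)

transposition-involutive : ∀ i j → transposition i (transposition i j) ≡ j
transposition-involutive zero    zero          = refl
transposition-involutive zero    (suc zero)    = refl
transposition-involutive zero    (suc (suc j)) = refl
transposition-involutive (suc i) zero          = refl
transposition-involutive (suc i) (suc j)       = cong suc (transposition-involutive i j)

transposition-fixes : ∀ i j → 2 ℕ.+ i ≤ j → transposition i j ≡ j
transposition-fixes zero    (suc (suc j)) _         = refl
transposition-fixes zero    (suc zero)    (s≤s ())
transposition-fixes (suc i) (suc j)       (s≤s i≤j) = cong suc (transposition-fixes i j i≤j)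

s : ℕ → S∞
s i = record
  { perm  = mk↔ₛ′ (transposition i) (transposition i)
                  (transposition-involutive i) (transposition-involutive i)
  ; bound = 2 ℕ.+ i
  ; fixes = transposition-fixes i
  }

IsInversion : S∞ → ℕ × ℕ → Set
IsInversion u (i , j) = i < j × to u j < to u i

isInversion? : ∀ u p → Dec (IsInversion u p)
isInversion? u (i , j) = (i ℕ.<? j) ×-dec (to u j ℕ.<? to u i)

inversions : S∞ → List (ℕ × ℕ)
inversions u = filter (isInversion? u) (cartesianProduct (upTo (bound u)) (upTo (bound u)))

ℓ : S∞ → ℕ
ℓ u = length (inversions u)

-- No inversion is lost by only listing pairs below the bound, so ℓ does
-- not depend on the bound recorded in the permutation.

to-injective : ∀ u {i j} → to u i ≡ to u j → i ≡ j
to-injective u {i} {j} eq = trans (sym (Inverse.strictlyInverseʳ (S∞.perm u) i))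
  (trans (cong (S∞.from u) eq) (Inverse.strictlyInverseʳ (S∞.perm u) j))

∈-inversions : ∀ u {p} → IsInversion u p → p ∈ inversions u
∈-inversions u {i , j} (i<j , uj<ui) = ∈-filter⁺ (isInversion? u)
  (∈-cartesianProduct⁺ (∈-upTo⁺ (ℕ.<-trans i<j j<N)) (∈-upTo⁺ j<N)) (i<j , uj<ui)
  where
  j<N : j < bound u
  j<N with ℕ.<-≤-connex j (bound u)
  ... | inj₁ j<N = j<N
  ... | inj₂ N≤j = contradiction i<i (ℕ.<-irrefl refl)
    where
    j<ui : j < to u i
    j<ui = subst (_< to u i) (fixes u j N≤j) uj<ui
    ui≡i : to u i ≡ i
    ui≡i = to-injective u (fixes u (to u i) (ℕ.≤-trans N≤j (ℕ.<⇒≤ j<ui)))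
    i<i : i < i
    i<i = subst (i <_) ui≡i (ℕ.<-trans i<j j<ui)

------------------------------------------------------------------------
-- The monomial x_{j₁} ⋯ x_{jₖ} is the list j₁ ∷ … ∷ jₖ ∷ [], considered up
-- to permutation, and a polynomial is a formal sum of terms, considered
-- up to equality of all coefficients.

Monomial : Set
Monomial = List ℕ

_↭?_ : (m m′ : Monomial) → Dec (m ↭ m′)
[]      ↭? []       = yes ↭-refl
[]      ↭? (j ∷ m′) = no λ p → contradiction (↭-length p) λ ()
(j ∷ m) ↭? m′ with member? ℕ._≟_ j m′
... | no  j∉m′ = no λ p → j∉m′ (∈-resp-↭ p (here refl))
... | yes j∈m′ with ∈-∃++ j∈m′
...   | a , b , refl = map′
  (λ p → ↭-trans (prep j p) (↭-sym (shift j a b)))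
  (λ p → drop-∷ (↭-trans p (shift j a b)))
  (m ↭? (a ++ b))

Poly : Set
Poly = List (ℤ × Monomial)

coeff : Monomial → Poly → ℤ
coeff m []             = 0ℤ
coeff m ((c , m′) ∷ P) = (if does (m ↭? m′) then c else 0ℤ) + coeff m P

_≈ₚ_ : Poly → Poly → Set
P ≈ₚ Q = ∀ m → coeff m P ≡ coeff m Q

HasNonNegativeCoefficients : Poly → Set
HasNonNegativeCoefficients P = ∀ m → 0ℤ ℤ.≤ coeff m P

0ₚ 1ₚ : Poly
0ₚ = []
1ₚ = (1ℤ , []) ∷ []

x : ℕ → Poly
x i = (1ℤ , i ∷ []) ∷ []

_+ₚ_ _-ₚ_ _*ₚ_ : Poly → Poly → Poly
P +ₚ Q = P ++ Q
P -ₚ Q = P ++ map (map₁ (λ c → - c)) Q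
P *ₚ Q = cartesianProductWith (zip _*_ _++_) P Q

_^ₚ_ : Poly → ℕ → Poly
P ^ₚ zero  = 1ₚ
P ^ₚ suc k = P *ₚ P ^ₚ k

_·_ : ℤ → Poly → Poly
c · P = map (map₁ (c *_)) P

_▷_ : S∞ → Poly → Poly
u ▷ P = map (map₂ (map (to u))) P

-- The divided difference (P - s_i P) / (x_i - x_{i+1}), computed from
-- ∂ (x_j Q) = ∂ (x_j) Q + s_i (x_j) ∂ Q.  That it is this quotient is
-- ∂-quotient below.

∂-variable : ℕ → ℕ → ℤ
∂-variable i j =
  if does (j ℕ.≟ i) then 1ℤ else if does (j ℕ.≟ suc i) then -1ℤ else 0ℤ

∂-monomial : ℕ → Monomial → Poly
∂-monomial i []      = 0ₚ
∂-monomial i (j ∷ m) =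
  ((∂-variable i j , m) ∷ []) +ₚ x (to (s i) j) *ₚ ∂-monomial i m

∂ : ℕ → Poly → Poly
∂ i P = concatMap (λ (c , m) → c · ∂-monomial i m) P

coeff-++ : ∀ m P Q → coeff m (P ++ Q) ≡ coeff m P + coeff m Q
coeff-++ m []             Q = sym (ℤ.+-identityˡ (coeff m Q))
coeff-++ m ((c , m′) ∷ P) Q = trans (cong ((if does (m ↭? m′) then c else 0ℤ) +_) (coeff-++ m P Q))
  (sym (ℤ.+-assoc (if does (m ↭? m′) then c else 0ℤ) (coeff m P) (coeff m Q)))

private

  δ : Monomial → Monomial → ℤ
  δ m a = if does (m ↭? a) then 1ℤ else 0ℤ

  coeff-term : ∀ m c a → (if does (m ↭? a) then c else 0ℤ) ≡ c * δ m a
  coeff-term m c a with m ↭? a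
  ... | yes _ = sym (ℤ.*-identityʳ c)
  ... | no  _ = sym (ℤ.*-zeroʳ c)

  coeff-∷ : ∀ m c a P → coeff m ((c , a) ∷ P) ≡ c * δ m a + coeff m P
  coeff-∷ m c a P = cong (_+ coeff m P) (coeff-term m c a)

  δ-cong : ∀ {m a n b} → (m ↭ a → n ↭ b) → (n ↭ b → m ↭ a) → δ m a ≡ δ n b
  δ-cong {m} {a} {n} {b} f g with m ↭? a | n ↭? b
  ... | yes _ | yes _ = refl
  ... | no  _ | no  _ = refl
  ... | yes p | no ¬q = contradiction (f p) ¬q
  ... | no ¬p | yes q = contradiction (g q) ¬p

  δ-no : ∀ {m a} → ¬ (m ↭ a) → δ m a ≡ 0ℤ
  δ-no {m} {a} ¬p with m ↭? a
  ... | yes p = contradiction p ¬p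
  ... | no  _ = refl

  coeff-· : ∀ m c P → coeff m (c · P) ≡ c * coeff m P
  coeff-· m c []            = sym (ℤ.*-zeroʳ c)
  coeff-· m c ((d , a) ∷ P) = begin
    coeff m ((c * d , a) ∷ c · P)                 ≡⟨ coeff-∷ m (c * d) a (c · P) ⟩
    (c * d) * δ m a + coeff m (c · P)         ≡⟨ cong₂ _+_ (ℤ.*-assoc c d (δ m a)) (coeff-· m c P) ⟩
    c * (d * δ m a) + c * coeff m P         ≡⟨ ℤ.*-distribˡ-+ c (d * δ m a) (coeff m P) ⟨
    c * (d * δ m a + coeff m P)               ≡⟨ cong (c *_) (coeff-∷ m d a P) ⟨
    c * coeff m ((d , a) ∷ P)                     ∎
    where open ≡-Reasoning

  coeff-neg : ∀ m P → coeff m (map (map₁ (λ c → - c)) P) ≡ - coeff m P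
  coeff-neg m []            = refl
  coeff-neg m ((c , a) ∷ P) = begin
    coeff m ((- c , a) ∷ N)            ≡⟨ coeff-∷ m (- c) a N ⟩
    (- c) * δ m a + coeff m N          ≡⟨ cong ((- c) * δ m a +_) (coeff-neg m P) ⟩
    (- c) * δ m a + - coeff m P        ≡⟨ lemma c (δ m a) (coeff m P) ⟩
    - (c * δ m a + coeff m P)            ≡⟨ cong -_ (coeff-∷ m c a P) ⟨
    - coeff m ((c , a) ∷ P)                  ∎
    where
    open ≡-Reasoning
    N = map (map₁ (λ c → - c)) P
    lemma : ∀ c d e → (- c) * d + - e ≡ - (c * d + e)
    lemma = solve-∀

  infixr 7 _◃_
  _◃_ : ℕ → Poly → Poly
  j ◃ P = map (map₂ (j ∷_)) P

  x* : ∀ m c j P → coeff m (((c , j ∷ []) ∷ []) *ₚ P) ≡ c * coeff m (j ◃ P)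
  x* m c j []            = sym (ℤ.*-zeroʳ c)
  x* m c j ((d , a) ∷ P) = begin
    coeff m ((c * d , j ∷ a) ∷ ((c , j ∷ []) ∷ []) *ₚ P)
      ≡⟨ coeff-∷ m (c * d) (j ∷ a) (((c , j ∷ []) ∷ []) *ₚ P) ⟩
    (c * d) * δ m (j ∷ a) + coeff m (((c , j ∷ []) ∷ []) *ₚ P)
      ≡⟨ cong₂ _+_ (ℤ.*-assoc c d (δ m (j ∷ a))) (x* m c j P) ⟩
    c * (d * δ m (j ∷ a)) + c * coeff m (j ◃ P)
      ≡⟨ ℤ.*-distribˡ-+ c (d * δ m (j ∷ a)) (coeff m (j ◃ P)) ⟨
    c * (d * δ m (j ∷ a) + coeff m (j ◃ P))
      ≡⟨ cong (c *_) (coeff-∷ m d (j ∷ a) (j ◃ P)) ⟨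
    c * coeff m (j ◃ ((d , a) ∷ P)) ∎
    where open ≡-Reasoning

  x*◃ : ∀ m j P → coeff m (x j *ₚ P) ≡ coeff m (j ◃ P)
  x*◃ m j P = trans (x* m 1ℤ j P) (ℤ.*-identityˡ (coeff m (j ◃ P)))

  ◃-∈ : ∀ j m m′ P → m ↭ j ∷ m′ → coeff m (j ◃ P) ≡ coeff m′ P
  ◃-∈ j m m′ []            p = refl
  ◃-∈ j m m′ ((c , a) ∷ P) p = begin
    coeff m ((c , j ∷ a) ∷ j ◃ P)               ≡⟨ coeff-∷ m c (j ∷ a) (j ◃ P) ⟩
    c * δ m (j ∷ a) + coeff m (j ◃ P)       ≡⟨ cong₂ (λ d e → c * d + e)
      (δ-cong (λ q → drop-∷ (↭-trans (↭-sym p) q)) (λ q → ↭-trans p (prep j q)))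
      (◃-∈ j m m′ P p) ⟩
    c * δ m′ a + coeff m′ P                 ≡⟨ coeff-∷ m′ c a P ⟨
    coeff m′ ((c , a) ∷ P)                      ∎
    where open ≡-Reasoning

  ◃-∉ : ∀ j m P → ¬ (j ∈ m) → coeff m (j ◃ P) ≡ 0ℤ
  ◃-∉ j m []            j∉m = refl
  ◃-∉ j m ((c , a) ∷ P) j∉m = begin
    coeff m ((c , j ∷ a) ∷ j ◃ P)               ≡⟨ coeff-∷ m c (j ∷ a) (j ◃ P) ⟩
    c * δ m (j ∷ a) + coeff m (j ◃ P)       ≡⟨ cong₂ (λ d e → c * d + e)
      (δ-no (λ p → j∉m (∈-resp-↭ (↭-sym p) (here refl)))) (◃-∉ j m P j∉m) ⟩
    c * 0ℤ + 0ℤ                             ≡⟨ cong (_+ 0ℤ) (ℤ.*-zeroʳ c) ⟩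
    0ℤ                                          ∎
    where open ≡-Reasoning

  ◃-cong : ∀ j P Q → P ≈ₚ Q → j ◃ P ≈ₚ j ◃ Q
  ◃-cong j P Q P≈Q m with member? ℕ._≟_ j m
  ... | no  j∉m = trans (◃-∉ j m P j∉m) (sym (◃-∉ j m Q j∉m))
  ... | yes j∈m with ∈-∃++ j∈m
  ...   | a , b , refl = trans (◃-∈ j m (a ++ b) P (shift j a b))
    (trans (P≈Q (a ++ b)) (sym (◃-∈ j m (a ++ b) Q (shift j a b))))

  ◃-comm : ∀ i j P → i ◃ j ◃ P ≈ₚ j ◃ i ◃ P
  ◃-comm i j []            m = refl
  ◃-comm i j ((c , a) ∷ P) m = begin
    coeff m ((c , i ∷ j ∷ a) ∷ i ◃ j ◃ P)            ≡⟨ coeff-∷ m c (i ∷ j ∷ a) (i ◃ j ◃ P) ⟩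
    c * δ m (i ∷ j ∷ a) + coeff m (i ◃ j ◃ P)    ≡⟨ cong₂ (λ d e → c * d + e)
      (δ-cong {m} {i ∷ j ∷ a} {m} {j ∷ i ∷ a} (λ p → ↭-trans p (swap i j ↭-refl)) (λ p → ↭-trans p (swap j i ↭-refl)))
      (◃-comm i j P m) ⟩
    c * δ m (j ∷ i ∷ a) + coeff m (j ◃ i ◃ P)    ≡⟨ coeff-∷ m c (j ∷ i ∷ a) (j ◃ i ◃ P) ⟨
    coeff m ((c , j ∷ i ∷ a) ∷ j ◃ i ◃ P)            ∎
    where open ≡-Reasoning

  ◃-++ : ∀ j m P Q → coeff m (j ◃ (P ++ Q)) ≡ coeff m (j ◃ P) + coeff m (j ◃ Q)
  ◃-++ j m P Q = trans (cong (coeff m) (map-++ (map₂ (j ∷_)) P Q)) (coeff-++ m (j ◃ P) (j ◃ Q))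

  ◃-· : ∀ j c P → j ◃ (c · P) ≡ c · (j ◃ P)
  ◃-· j c []      = refl
  ◃-· j c (t ∷ P) = cong (_ ∷_) (◃-· j c P)

  ◃-neg : ∀ j P → j ◃ map (map₁ (λ c → - c)) P ≡ map (map₁ (λ c → - c)) (j ◃ P)
  ◃-neg j []      = refl
  ◃-neg j (t ∷ P) = cong (_ ∷_) (◃-neg j P)

  ◃-- : ∀ j m P Q → coeff m (j ◃ (P -ₚ Q)) ≡ coeff m (j ◃ P) - coeff m (j ◃ Q)
  ◃-- j m P Q = trans (◃-++ j m P _) (cong (coeff m (j ◃ P) +_)
    (trans (cong (coeff m) (◃-neg j Q)) (coeff-neg m (j ◃ Q))))

  coeff-- : ∀ m P Q → coeff m (P -ₚ Q) ≡ coeff m P - coeff m Q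
  coeff-- m P Q = trans (coeff-++ m P _) (cong (coeff m P +_) (coeff-neg m Q))

  variable-case : ∀ i j (f : ℕ → ℤ) →
    ∂-variable i j * (f i - f (suc i)) + f (transposition i j) ≡ f j
  variable-case zero    zero          f = lemma (f 0) (f 1)
    where
    lemma : ∀ a b → 1ℤ * (a - b) + b ≡ a
    lemma = solve-∀
  variable-case zero    (suc zero)    f = lemma (f 0) (f 1)
    where
    lemma : ∀ a b → -1ℤ * (a - b) + a ≡ b
    lemma = solve-∀
  variable-case zero    (suc (suc j)) f = ℤ.+-identityˡ (f (suc (suc j)))
  variable-case (suc i) zero          f = ℤ.+-identityˡ (f zero)
  variable-case (suc i) (suc j)       f = variable-case i j (f ∘ suc)

  [_] : Monomial → Poly
  [ a ] = (1ℤ , a) ∷ []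

  coeff-[] : ∀ m c a → coeff m ((c , a) ∷ []) ≡ c * coeff m [ a ]
  coeff-[] m c a = trans (coeff-∷ m c a [])
    (trans (ℤ.+-identityʳ _) (cong (c *_) (sym (ℤ.+-identityʳ (δ m a)))))

  quotient-monomial : ∀ i a →
    (i ◃ ∂-monomial i a) -ₚ (suc i ◃ ∂-monomial i a) ≈ₚ [ a ] -ₚ [ map (transposition i) a ]
  quotient-monomial i []      m = sym (trans (coeff-- m [ [] ] [ [] ]) (ℤ.+-inverseʳ (coeff m [ [] ])))
  quotient-monomial i (j ∷ a) m = begin
    coeff m ((i ◃ (E ++ sj *R)) -ₚ (suc i ◃ (E ++ sj *R)))
      ≡⟨ coeff-- m (i ◃ (E ++ sj *R)) (suc i ◃ (E ++ sj *R)) ⟩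
    coeff m (i ◃ (E ++ sj *R)) - coeff m (suc i ◃ (E ++ sj *R))
      ≡⟨ cong₂ _-_ (part i) (part (suc i)) ⟩
    (e * F i + coeff m (sj ◃ i ◃ R)) - (e * F (suc i) + coeff m (sj ◃ suc i ◃ R))
      ≡⟨ lemma₁ e (F i) (F (suc i)) (coeff m (sj ◃ i ◃ R)) (coeff m (sj ◃ suc i ◃ R)) ⟩
    e * (F i - F (suc i)) + (coeff m (sj ◃ i ◃ R) - coeff m (sj ◃ suc i ◃ R))
      ≡⟨ cong (e * (F i - F (suc i)) +_) (trans (sym (◃-- sj m (i ◃ R) (suc i ◃ R)))
           (trans (◃-cong sj ((i ◃ R) -ₚ (suc i ◃ R)) ([ a ] -ₚ [ sa ]) (quotient-monomial i a) m)
                  (◃-- sj m [ a ] [ sa ]))) ⟩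
    e * (F i - F (suc i)) + (F sj - coeff m [ sj ∷ sa ])
      ≡⟨ ℤ.+-assoc (e * (F i - F (suc i))) (F sj) (- coeff m [ sj ∷ sa ]) ⟨
    (e * (F i - F (suc i)) + F sj) - coeff m [ sj ∷ sa ]
      ≡⟨ cong (_- coeff m [ sj ∷ sa ]) (variable-case i j F) ⟩
    F j - coeff m [ sj ∷ sa ]
      ≡⟨ coeff-- m [ j ∷ a ] [ sj ∷ sa ] ⟨
    coeff m ([ j ∷ a ] -ₚ [ sj ∷ sa ]) ∎
    where
    open ≡-Reasoning
    sj = transposition i j
    sa = map (transposition i) a
    e = ∂-variable i j
    E = (e , a) ∷ []
    R = ∂-monomial i a
    _*R : ℕ → Poly
    k *R = x k *ₚ R
    F : ℕ → ℤ
    F k = coeff m [ k ∷ a ]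
    part : ∀ k → coeff m (k ◃ (E ++ sj *R)) ≡ e * F k + coeff m (sj ◃ k ◃ R)
    part k = trans (◃-++ k m E (sj *R)) (cong₂ _+_ (coeff-[] m e (k ∷ a))
      (trans (◃-cong k (sj *R) (sj ◃ R) (λ n → x*◃ n sj R) m) (◃-comm k sj R m)))
    lemma₁ : ∀ e f g h k →
      (e * f + h) - (e * g + k) ≡ e * (f - g) + (h - k)
    lemma₁ = solve-∀

  quotient : ∀ i P m →
    coeff m (i ◃ ∂ i P) - coeff m (suc i ◃ ∂ i P) ≡ coeff m P - coeff m (s i ▷ P)
  quotient i []            m = refl
  quotient i ((c , a) ∷ P) m = begin
    coeff m (i ◃ (c · R ++ ∂ i P)) - coeff m (suc i ◃ (c · R ++ ∂ i P))
      ≡⟨ cong₂ _-_ (part i) (part (suc i)) ⟩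
    (c * coeff m (i ◃ R) + coeff m (i ◃ ∂ i P)) - (c * coeff m (suc i ◃ R) + coeff m (suc i ◃ ∂ i P))
      ≡⟨ lemma c (coeff m (i ◃ R)) (coeff m (suc i ◃ R)) (coeff m (i ◃ ∂ i P)) (coeff m (suc i ◃ ∂ i P)) ⟩
    c * (coeff m (i ◃ R) - coeff m (suc i ◃ R)) + (coeff m (i ◃ ∂ i P) - coeff m (suc i ◃ ∂ i P))
      ≡⟨ cong₂ (λ d e → c * d + e)
           (trans (sym (coeff-- m (i ◃ R) (suc i ◃ R))) (trans (quotient-monomial i a m) (coeff-- m [ a ] [ sa ])))
           (quotient i P m) ⟩
    c * (coeff m [ a ] - coeff m [ sa ]) + (coeff m P - coeff m (s i ▷ P))
      ≡⟨ lemma c (coeff m [ a ]) (coeff m [ sa ]) (coeff m P) (coeff m (s i ▷ P)) ⟨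
    (c * coeff m [ a ] + coeff m P) - (c * coeff m [ sa ] + coeff m (s i ▷ P))
      ≡⟨ cong₂ _-_ (term a P) (term sa (s i ▷ P)) ⟩
    coeff m ((c , a) ∷ P) - coeff m ((c , sa) ∷ s i ▷ P) ∎
    where
    open ≡-Reasoning
    R = ∂-monomial i a
    sa = map (transposition i) a
    part : ∀ k → coeff m (k ◃ (c · R ++ ∂ i P)) ≡ c * coeff m (k ◃ R) + coeff m (k ◃ ∂ i P)
    part k = trans (◃-++ k m (c · R) (∂ i P)) (cong (_+ coeff m (k ◃ ∂ i P))
      (trans (cong (coeff m) (◃-· k c R)) (coeff-· m c (k ◃ R))))
    term : ∀ b Q → c * coeff m [ b ] + coeff m Q ≡ coeff m ((c , b) ∷ Q)
    term b Q = sym (trans (coeff-∷ m c b Q)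
      (cong (λ d → c * d + coeff m Q) (sym (ℤ.+-identityʳ (δ m b)))))
    lemma : ∀ c f g h k →
      (c * f + h) - (c * g + k) ≡ c * (f - g) + (h - k)
    lemma = solve-∀

∂-quotient : ∀ i P → (x i -ₚ x (suc i)) *ₚ ∂ i P ≈ₚ P -ₚ s i ▷ P
∂-quotient i P m = begin
  coeff m ((x i -ₚ x (suc i)) *ₚ Q)
    ≡⟨ coeff-++ m (map (zip _*_ _++_ (1ℤ , i ∷ [])) Q) _ ⟩
  coeff m (map (zip _*_ _++_ (1ℤ , i ∷ [])) Q) + coeff m (((-1ℤ , suc i ∷ []) ∷ []) *ₚ Q)
    ≡⟨ cong₂ _+_ (trans (cong (coeff m) (sym (++-identityʳ (map (zip _*_ _++_ (1ℤ , i ∷ [])) Q)))) (x*◃ m i Q)) (x* m -1ℤ (suc i) Q) ⟩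
  coeff m (i ◃ Q) + -1ℤ * coeff m (suc i ◃ Q)
    ≡⟨ cong (coeff m (i ◃ Q) +_) (ℤ.-1*i≡-i (coeff m (suc i ◃ Q))) ⟩
  coeff m (i ◃ Q) - coeff m (suc i ◃ Q)
    ≡⟨ quotient i P m ⟩
  coeff m P - coeff m (s i ▷ P)
    ≡⟨ coeff-- m P (s i ▷ P) ⟨
  coeff m (P -ₚ s i ▷ P) ∎
  where
  open ≡-Reasoning
  Q = ∂ i P

------------------------------------------------------------------------
-- IsSkewDividedDifference u w D says that D is the operator ∂_u^w, as
-- evaluated by the recurrence along some choice of descents of w.  Such
-- an operator exists for all u and w (skewDividedDifference below), and
-- it is well known not to depend on the choices.

data IsSkewDividedDifference (u w : S∞) : (Poly → Poly) → Set where

  identity : w ≈ 𝟙 → u ≈ 𝟙 → IsSkewDividedDifference u w id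

  vanish : w ≈ 𝟙 → ¬ (u ≈ 𝟙) → IsSkewDividedDifference u w (const 0ₚ)

  descent : ∀ i {D D′} → ℓ (w ∙ s i) < ℓ w → ℓ (u ∙ s i) < ℓ u →
    IsSkewDividedDifference u (w ∙ s i) D →
    IsSkewDividedDifference (u ∙ s i) (w ∙ s i) D′ →
    IsSkewDividedDifference u w (λ P → D (∂ i P) +ₚ D′ (s i ▷ P))

  ascent : ∀ i {D} → ℓ (w ∙ s i) < ℓ w → ℓ (u ∙ s i) ℕ.> ℓ u →
    IsSkewDividedDifference u (w ∙ s i) D →
    IsSkewDividedDifference u w (λ P → D (∂ i P))

private

  length-≤ : ∀ {A : Set} {xs : List A} (ys : List A) →
    Unique xs → (∀ {a} → a ∈ xs → a ∈ ys) → length xs ≤ length ys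
  length-≤ {xs = []}     ys _        _ = z≤n
  length-≤ {xs = a ∷ xs} ys (a∉ ∷ !) f with ∈-∃++ (f (here refl))
  ... | bs , cs , refl = subst (suc (length xs) ≤_) (sym (↭-length (shift a bs cs)))
    (s≤s (length-≤ (bs ++ cs) ! g))
    where
    g : ∀ {b} → b ∈ xs → b ∈ bs ++ cs
    g b∈xs with ∈-resp-↭ (shift a bs cs) (f (there b∈xs))
    ... | here refl = contradiction refl (All.lookup a∉ b∈xs)
    ... | there b∈  = b∈

  inversions-unique : ∀ u → Unique (inversions u)
  inversions-unique u = Unique.filter⁺ (isInversion? u)
    (Unique.cartesianProduct⁺ (Unique.upTo⁺ (bound u)) (Unique.upTo⁺ (bound u)))

  inversions⁻ : ∀ u {p} → p ∈ inversions u → IsInversion u p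
  inversions⁻ u p∈ = proj₂ (∈-filter⁻ (isInversion? u) {xs = cartesianProduct (upTo (bound u)) (upTo (bound u))} p∈)

  transposition-< : ∀ i {a b} → a < b → (a ≡ i × b ≡ suc i) ⊎ transposition i a < transposition i b
  transposition-< zero    {zero}        {suc zero}    _ = inj₁ (refl , refl)
  transposition-< zero    {zero}        {suc (suc b)} _ = inj₂ (s≤s (s≤s z≤n))
  transposition-< zero    {suc zero}    {suc (suc b)} _ = inj₂ (s≤s z≤n)
  transposition-< zero    {suc (suc a)} {suc (suc b)} p = inj₂ p
  transposition-< zero    {suc a}       {suc zero}    (s≤s ())
  transposition-< (suc i) {zero}        {suc b}       _ = inj₂ (s≤s z≤n)
  transposition-< (suc i) {suc a}       {suc b}       (s≤s p) with transposition-< i p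
  ... | inj₁ (refl , refl) = inj₁ (refl , refl)
  ... | inj₂ q             = inj₂ (s≤s q)

  transposition-i : ∀ i → transposition i i ≡ suc i
  transposition-i zero    = refl
  transposition-i (suc i) = cong suc (transposition-i i)

  transposition-1+i : ∀ i → transposition i (suc i) ≡ i
  transposition-1+i zero    = refl
  transposition-1+i (suc i) = cong suc (transposition-1+i i)

  ℓ-descent : ∀ w w′ i → w′ ≈ w ∙ s i → to w (suc i) < to w i → ℓ w′ < ℓ w
  ℓ-descent w w′ i w′≈ws desc = subst (λ k → suc k ≤ ℓ w) (length-map f (inversions w′))
    (length-≤ (inversions w) (fresh ∷ Unique.map⁺ f-injective (inversions-unique w′)) sub)
    where
    t = transposition i
    f : ℕ × ℕ → ℕ × ℕ
    f (a , b) = t a , t b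
    t-injective : ∀ {a b} → t a ≡ t b → a ≡ b
    t-injective {a} {b} eq = trans (sym (transposition-involutive i a))
      (trans (cong t eq) (transposition-involutive i b))
    f-injective : ∀ {p q} → f p ≡ f q → p ≡ q
    f-injective eq = cong₂ _,_ (t-injective (cong proj₁ eq)) (t-injective (cong proj₂ eq))
    fresh : All ((i , suc i) ≢_) (map f (inversions w′))
    fresh = All.tabulate λ {q} q∈ → λ { refl → helper q∈ }
      where
      helper : ¬ ((i , suc i) ∈ map f (inversions w′))
      helper q∈ with ∈-map⁻ f q∈
      ... | (a , b) , p∈ , eq = ℕ.<-asym (proj₁ (inversions⁻ w′ p∈))
        (subst (_< a) (sym b≡i) (subst (i <_) (sym a≡1+i) (ℕ.n<1+n i)))
        where
        a≡1+i : a ≡ suc i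
        a≡1+i = t-injective (trans (sym (cong proj₁ eq)) (sym (transposition-1+i i)))
        b≡i : b ≡ i
        b≡i = t-injective (trans (sym (cong proj₂ eq)) (sym (transposition-i i)))
    keep : ∀ {p} → IsInversion w′ p → IsInversion w (f p)
    keep {a , b} (a<b , w′b<w′a) with transposition-< i a<b
    ... | inj₂ ta<tb         = ta<tb , wtb<wta
      where
      wtb<wta : to w (t b) < to w (t a)
      wtb<wta = subst (_< to w (t a)) (w′≈ws b) (subst (to w′ b <_) (w′≈ws a) w′b<w′a)
    ... | inj₁ (refl , refl) = contradiction desc (ℕ.<-asym wi<w1+i)
      where
      wi<w1+i : to w i < to w (suc i)
      wi<w1+i = subst (_< to w (suc i)) (trans (w′≈ws (suc i)) (cong (to w) (transposition-1+i i)))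
        (subst (to w′ (suc i) <_) (trans (w′≈ws i) (cong (to w) (transposition-i i))) w′b<w′a)
    sub : ∀ {q} → q ∈ (i , suc i) ∷ map f (inversions w′) → q ∈ inversions w
    sub (here refl) = ∈-inversions w (ℕ.n<1+n i , desc)
    sub (there q∈) with ∈-map⁻ f q∈
    ... | p , p∈ , refl = ∈-inversions w (keep (inversions⁻ w′ p∈))

  ℓ-dichotomy : ∀ u i → ℓ (u ∙ s i) < ℓ u ⊎ ℓ (u ∙ s i) ℕ.> ℓ u
  ℓ-dichotomy u i with ℕ.<-cmp (to u (suc i)) (to u i)
  ... | tri< d _ _  = inj₁ (ℓ-descent u (u ∙ s i) i (λ _ → refl) d)
  ... | tri≈ _ eq _ = contradiction (to-injective u eq) (ℕ.m≢1+n+m i {0} ∘ sym)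
  ... | tri> _ _ d  = inj₂ (ℓ-descent (u ∙ s i) u i
    (λ j → cong (to u) (sym (transposition-involutive i j)))
    (subst (_< to u (transposition i i)) (cong (to u) (sym (transposition-1+i i)))
      (subst (to u i <_) (cong (to u) (sym (transposition-i i))) d)))

  increasing⇒𝟙 : ∀ w → (∀ i → i < bound w → to w i < to w (suc i)) → w ≈ 𝟙
  increasing⇒𝟙 w inc i = ℕ.≤-antisym (upper i) (lower i)
    where
    inc′ : ∀ i → to w i < to w (suc i)
    inc′ i with ℕ.<-≤-connex i (bound w)
    ... | inj₁ i<N = inc i i<N
    ... | inj₂ N≤i = subst (_< to w (suc i)) (sym (fixes w i N≤i))
      (subst (i <_) (sym (fixes w (suc i) (ℕ.m≤n⇒m≤1+n N≤i))) (ℕ.n<1+n i))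
    lower : ∀ i → i ≤ to w i
    lower zero    = z≤n
    lower (suc i) = ℕ.≤-<-trans (lower i) (inc′ i)
    shifted : ∀ k i → to w i ℕ.+ k ≤ to w (k ℕ.+ i)
    shifted zero    i = ℕ.≤-reflexive (ℕ.+-identityʳ (to w i))
    shifted (suc k) i = subst (_≤ to w (suc (k ℕ.+ i))) (sym (ℕ.+-suc (to w i) k))
      (ℕ.≤-<-trans (shifted k i) (inc′ (k ℕ.+ i)))
    upper : ∀ i → to w i ≤ i
    upper i = ℕ.+-cancelʳ-≤ (bound w) (to w i) i
      (subst (to w i ℕ.+ bound w ≤_) (trans (fixes w (bound w ℕ.+ i) (ℕ.m≤m+n (bound w) i)) (ℕ.+-comm (bound w) i))
        (shifted (bound w) i))

  descent⊎𝟙 : ∀ w → (∃ λ i → ℓ (w ∙ s i) < ℓ w) ⊎ w ≈ 𝟙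
  descent⊎𝟙 w with ℕ.anyUpTo? (λ i → to w (suc i) ℕ.<? to w i) (bound w)
  ... | yes (i , _ , d) = inj₁ (i , ℓ-descent w (w ∙ s i) i (λ _ → refl) d)
  ... | no  ¬d          = inj₂ (increasing⇒𝟙 w λ i i<N →
    ℕ.≤∧≢⇒< (ℕ.≮⇒≥ λ d → ¬d (i , i<N , d)) λ eq → ℕ.m≢1+n+m i {0} (to-injective w eq))

  ≈𝟙? : ∀ u → Dec (u ≈ 𝟙)
  ≈𝟙? u = map′
    (λ h i → [ (λ i<N → h i<N) , fixes u i ]′ (ℕ.<-≤-connex i (bound u)))
    (λ h {i} _ → h i)
    (ℕ.allUpTo? (λ i → to u i ℕ.≟ i) (bound u))

  construct : ∀ u w → Acc _<_ (ℓ w) → ∃ (IsSkewDividedDifference u w)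
  construct u w (acc rec) with descent⊎𝟙 w
  ... | inj₂ w≈𝟙 with ≈𝟙? u
  ...   | yes u≈𝟙 = _ , identity w≈𝟙 u≈𝟙
  ...   | no  u≉𝟙 = _ , vanish w≈𝟙 u≉𝟙
  construct u w (acc rec) | inj₁ (i , d) with ℓ-dichotomy u i
  ...   | inj₁ e = _ , descent i d e
    (proj₂ (construct u (w ∙ s i) (rec d))) (proj₂ (construct (u ∙ s i) (w ∙ s i) (rec d)))
  ...   | inj₂ e = _ , ascent i d e (proj₂ (construct u (w ∙ s i) (rec d)))

skewDividedDifference : ∀ u w → ∃ (IsSkewDividedDifference u w)
skewDividedDifference u w = construct u w (<-wellFounded (ℓ w))

-- The Schubert polynomial of the longest element w₀(n) of S_{n+1}: with
-- indices from 0, the usual x_i^(n+1-i) for 1 ≤ i ≤ n becomes x_i^(n-i)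
-- for 0 ≤ i < n.

𝔖w₀ : ℕ → Poly
𝔖w₀ n = foldr _*ₚ_ 1ₚ (map (λ i → x i ^ₚ (n ∸ i)) (upTo n))

{-# OPTIONS --safe #-}

-- Encode ∂_u^w in the nilCoxeter algebra: s_i acts on functions A from S∞ to
-- polynomials by an operator τ_i which packages both terms of the recurrence,
-- so that ∂_u^w(P) = (τ_a (P ⊗ u))(1) for any reduced word a of w.  These
-- operators satisfy the nilCoxeter relations, so by Matsumoto's argument the
-- choice of a does not matter.
--
-- 𝔖_{w₀(n)} is the product of the monomials x_0 ⋯ x_{k-1} for k ≤ n, so it is
-- enough to move one such monomial past a word a without producing signs.  It
-- commutes with τ_i for i ≠ k-1.  Up to such letters on the right, the word is
-- zero or that of a Grassmannian permutation, a product of rows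
-- s_{m_p-1} ⋯ s_p for p = 0, …, k-1 with m_0 < ⋯ < m_{k-1}.  In row p,
-- τ_i x_i = 1 + x_{i+1} τ_i moves x_p to the left positively, where it becomes
-- x_{m_p} and commutes with all rows further to the left.

module Submission where

open import Data.Bool.Base using (Bool; true; false; if_then_else_)
open import Data.Integer.Base as ℤ using (ℤ; 0ℤ; 1ℤ; -1ℤ; _+_; _-_; _*_; -_)
import Data.Integer.Properties as ℤ
open import Data.Integer.Tactic.RingSolver using (solve-∀)
open import Data.List.Base using (List; []; _∷_; _++_; _∷ʳ_; map; foldr; replicate; concatMap; cartesianProduct; upTo; applyUpTo; length)
open import Data.List.Membership.DecPropositional using () renaming (_∈?_ to member?)
open import Data.List.Membership.Propositional using (_∈_; _∉_)
open import Data.List.Membership.Propositional.Properties using (∈-∃++; ∈-map⁻; ∈-filter⁻)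
open import Data.List.Properties using (map-++; map-∘; map-cong; map-id; ++-identityʳ; concatMap-++; foldr-∷ʳ; foldr-++; length-map; length-++; length-replicate; upTo-∷ʳ)
open import Data.List.Relation.Binary.Permutation.Propositional as ↭ using (_↭_; ↭-refl; ↭-sym; ↭-trans; ↭-reflexive; prep; swap)
open import Data.List.Relation.Binary.Permutation.Propositional.Properties using (∈-resp-↭; drop-∷; shift; shifts; map⁺; ++⁺ˡ; ↭-length)
open import Data.List.Relation.Unary.All as All using (All; []; _∷_)
import Data.List.Relation.Unary.All.Properties as All
open import Data.List.Relation.Unary.AllPairs using ([]; _∷_)
open import Data.List.Relation.Unary.Any using (here; there)
open import Data.List.Relation.Unary.Linked using (Linked; [-]; _∷_)
open import Data.List.Relation.Unary.Unique.Propositional using (Unique)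
import Data.List.Relation.Unary.Unique.Propositional.Properties as Unique
open import Data.Nat.Base as ℕ using (ℕ; zero; suc; _<_; _≤_; _≥_; _⊔_; _∸_; z≤n; s≤s)
import Data.Nat.Properties as ℕ
open import Data.Product.Base using (∃; ∃₂; _×_; _,_; proj₁; proj₂; map₁; map₂; zip)
open import Data.Sum.Base using (_⊎_; inj₁; inj₂)
open import Function.Base using (_∘_; id)
open import Function.Bundles using (mk⇔; module Inverse)
open import Relation.Binary.Bundles using (Setoid)
open import Relation.Binary.Definitions using (Tri; tri<; tri≈; tri>)
open import Relation.Binary.PropositionalEquality using (_≡_; _≢_; refl; sym; trans; cong; cong₂; subst; subst₂; module ≡-Reasoning)
import Relation.Binary.Reasoning.Setoid
open import Relation.Nullary using (¬_; Dec; yes; no; does; contradiction)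
open import Relation.Nullary.Decidable using (does-⇔; dec-true; dec-false; map′)
open import Defs

-- Polynomials

-- The factor u⁻¹ only renames variables, so the question is the sign of ∂_u^w itself. The obstacle
-- is τ_i x_{i+1} = -1 + x_i τ_i: a variable that meets letters in the wrong order produces signs,
-- which rules out moving single variables through an arbitrary word. Inside one row, x_p meets s_p,
-- s_{p+1}, ... in turn as x_p, x_{p+1}, ..., so that rule is never applied to it.
--
-- Each term of the expansion leaves a word with letters omitted, which need not be reduced and has
-- no direct relation to w. The induction over the factors of 𝔖_{w₀(n)} therefore claims positivity
-- after every word, reduced or not.
--
-- `Element` is syntax rather than a function on S∞ so that the nilCoxeter relations follow by
-- structural induction: permutations enter only at the constants, and the Leibniz rule deals with
-- the variables.

infixr 7 _◃_

_◃_ : ℕ → Poly → Poly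
j ◃ P = map (map₂ (j ∷_)) P

mono : ℤ → Monomial → Poly
mono c m = (c , m) ∷ []

if-cong : ∀ {b b′} {A : Set} {x y : A} → b ≡ b′ → (if b then x else y) ≡ (if b′ then x else y)
if-cong refl = refl

coeff-resp-↭ : ∀ {m n} P → m ↭ n → coeff m P ≡ coeff n P
coeff-resp-↭ []            p = refl
coeff-resp-↭ {m} {n} ((c , a) ∷ P) p = cong₂ _+_
  (if-cong (does-⇔ (mk⇔ (↭-trans (↭-sym p)) (↭-trans p)) (m ↭? a) (n ↭? a)))
  (coeff-resp-↭ P p)

coeff-◃-∷ : ∀ j m P → coeff (j ∷ m) (j ◃ P) ≡ coeff m P
coeff-◃-∷ j m []            = refl
coeff-◃-∷ j m ((c , a) ∷ P) = cong₂ _+_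
  (if-cong (does-⇔ (mk⇔ drop-∷ (prep j)) (j ∷ m ↭? j ∷ a) (m ↭? a)))
  (coeff-◃-∷ j m P)

coeff-◃-∉ : ∀ {j m} P → j ∉ m → coeff m (j ◃ P) ≡ 0ℤ
coeff-◃-∉ []            j∉m = refl
coeff-◃-∉ {j} {m} ((c , a) ∷ P) j∉m = cong₂ _+_
  (if-cong (dec-false (m ↭? j ∷ a) λ p → j∉m (∈-resp-↭ (↭-sym p) (here refl))))
  (coeff-◃-∉ P j∉m)

-- Every monomial is a multiple of x_j or free of x_j, so these two cases
-- determine x_j P.
◃-elim : ∀ j (R : Monomial → Set) → (∀ {m n} → m ↭ n → R m → R n) →
  (∀ m → R (j ∷ m)) → (∀ {m} → j ∉ m → R m) → ∀ m → R m
◃-elim j R resp yes-case no-case m with member? ℕ._≟_ j m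
... | no  j∉m = no-case j∉m
... | yes j∈m with ∈-∃++ j∈m
...   | a , b , refl = resp (↭-sym (shift j a b)) (yes-case (a ++ b))

◃-cong : ∀ j {P Q} → P ≈ₚ Q → j ◃ P ≈ₚ j ◃ Q
◃-cong j {P} {Q} P≈Q = ◃-elim j (λ m → coeff m (j ◃ P) ≡ coeff m (j ◃ Q))
  (λ p e → trans (coeff-resp-↭ (j ◃ P) (↭-sym p)) (trans e (coeff-resp-↭ (j ◃ Q) p)))
  (λ m → trans (coeff-◃-∷ j m P) (trans (P≈Q m) (sym (coeff-◃-∷ j m Q))))
  (λ j∉m → trans (coeff-◃-∉ P j∉m) (sym (coeff-◃-∉ Q j∉m)))

◃-nonNegative : ∀ j {P} → HasNonNegativeCoefficients P → HasNonNegativeCoefficients (j ◃ P)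
◃-nonNegative j {P} P≥0 = ◃-elim j (λ m → 0ℤ ℤ.≤ coeff m (j ◃ P))
  (λ p → subst (0ℤ ℤ.≤_) (coeff-resp-↭ (j ◃ P) p))
  (λ m → subst (0ℤ ℤ.≤_) (sym (coeff-◃-∷ j m P)) (P≥0 m))
  (λ j∉m → ℤ.≤-reflexive (sym (coeff-◃-∉ P j∉m)))

◃-comm : ∀ j k P → j ◃ k ◃ P ≈ₚ k ◃ j ◃ P
◃-comm j k []            m = refl
◃-comm j k ((c , a) ∷ P) m = cong₂ _+_
  (if-cong (does-⇔ (mk⇔ (λ p → ↭-trans p (swap j k ↭-refl)) (λ p → ↭-trans p (swap k j ↭-refl)))
    (m ↭? j ∷ k ∷ a) (m ↭? k ∷ j ∷ a)))
  (◃-comm j k P m)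

if-* : ∀ b c d → (if b then c * d else 0ℤ) ≡ c * (if b then d else 0ℤ)
if-* true  c d = refl
if-* false c d = sym (ℤ.*-zeroʳ c)

-- One computation serves both scalar multiples (`f` the identity) and products with c x_j (`f`
-- prepending j).
coeff-scaled : ∀ (f : Monomial → Monomial) c P m →
  coeff m (map (λ (d , a) → c * d , f a) P) ≡ c * coeff m (map (map₂ f) P)
coeff-scaled f c []            m = sym (ℤ.*-zeroʳ c)
coeff-scaled f c ((d , a) ∷ P) m = trans
  (cong₂ _+_ (if-* (does (m ↭? f a)) c d) (coeff-scaled f c P m))
  (sym (ℤ.*-distribˡ-+ c _ _))

coeff-· : ∀ c P m → coeff m (c · P) ≡ c * coeff m P
coeff-· c P m = trans (coeff-scaled id c P m) (cong (λ Q → c * coeff m Q) (map-id P))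

coeff-x* : ∀ c j P m → coeff m (mono c (j ∷ []) *ₚ P) ≡ c * coeff m (j ◃ P)
coeff-x* c j P m = trans (cong (coeff m) (++-identityʳ (map (zip _*_ _++_ (c , j ∷ [])) P))) (coeff-scaled (j ∷_) c P m)

coeff-x : ∀ j P m → coeff m (x j *ₚ P) ≡ coeff m (j ◃ P)
coeff-x j P m = trans (coeff-x* 1ℤ j P m) (ℤ.*-identityˡ _)

coeff-neg : ∀ P m → coeff m (map (map₁ (λ c → - c)) P) ≡ - coeff m P
coeff-neg []            m = refl
coeff-neg ((c , a) ∷ P) m = trans (cong₂ _+_ (if-neg (does (m ↭? a))) (coeff-neg P m))
  (sym (ℤ.neg-distrib-+ (if does (m ↭? a) then c else 0ℤ) (coeff m P)))
  where
  if-neg : ∀ b → (if b then - c else 0ℤ) ≡ - (if b then c else 0ℤ)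
  if-neg true  = refl
  if-neg false = refl

coeff-- : ∀ P Q m → coeff m (P -ₚ Q) ≡ coeff m P - coeff m Q
coeff-- P Q m = trans (coeff-++ m P _) (cong (coeff m P +_) (coeff-neg Q m))

from-to : ∀ u j → to (u ⁻¹) (to u j) ≡ j
from-to u = Inverse.strictlyInverseʳ (S∞.perm u)

to-from : ∀ u j → to u (to (u ⁻¹) j) ≡ j
to-from u = Inverse.strictlyInverseˡ (S∞.perm u)

coeff-▷ : ∀ u P m → coeff m (u ▷ P) ≡ coeff (map (to (u ⁻¹)) m) P
coeff-▷ u []            m = refl
coeff-▷ u ((c , a) ∷ P) m = cong₂ _+_
  (if-cong (does-⇔ (mk⇔
    (λ p → ↭-trans (map⁺ (to (u ⁻¹)) p) (↭-reflexive (cancel _ _ (from-to u) a)))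
    (λ p → ↭-trans (↭-reflexive (sym (cancel _ _ (to-from u) m))) (map⁺ (to u) p)))
    (m ↭? map (to u) a) (map (to (u ⁻¹)) m ↭? a)))
  (coeff-▷ u P m)
  where
  cancel : ∀ (f g : ℕ → ℕ) → (∀ j → f (g j) ≡ j) → ∀ m → map f (map g m) ≡ m
  cancel f g fg m = trans (sym (map-∘ m)) (trans (map-cong fg m) (map-id m))

▷-cong : ∀ u {P Q} → P ≈ₚ Q → u ▷ P ≈ₚ u ▷ Q
▷-cong u {P} {Q} P≈Q m = trans (coeff-▷ u P m) (trans (P≈Q _) (sym (coeff-▷ u Q m)))

▷-◃ : ∀ u j P → u ▷ (j ◃ P) ≡ to u j ◃ (u ▷ P)
▷-◃ u j P = trans (sym (map-∘ P)) (map-∘ P)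

-- Exposes the exponent n of x_j, on which the cancellation argument below inducts.
isolate : ∀ j m → ∃₂ λ n r → m ↭ replicate n j ++ r × j ∉ r
isolate j []      = 0 , [] , ↭-refl , λ ()
isolate j (k ∷ m) with isolate j m | j ℕ.≟ k
... | n , r , p , j∉r | yes refl = suc n , r , prep j p , j∉r
... | n , r , p , j∉r | no j≢k   = n , k ∷ r , ↭-trans (prep k p) (↭-sym (shift k (replicate n j) r)) ,
  λ { (here e) → j≢k e ; (there q) → j∉r q }

-- x_i - x_j is not a zero divisor for i ≠ j: the coefficient of m in P is
-- that of x_i m in (x_i - x_j) P plus that of (x_i / x_j) m in P, and the
-- exponent of x_j decreases.
◃-cancel : ∀ i j {P Q} → i ≢ j →
  (∀ m → coeff m (i ◃ P) - coeff m (j ◃ P) ≡ coeff m (i ◃ Q) - coeff m (j ◃ Q)) → P ≈ₚ Q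
◃-cancel i j {P} {Q} i≢j eq m with isolate j m
... | n , r , p , j∉r = trans (coeff-resp-↭ P p) (trans (go n r j∉r) (sym (coeff-resp-↭ Q p)))
  where
  solve : ∀ {a b c d} → a - b ≡ c - d → b ≡ d → a ≡ c
  solve {a} {b} {c} {d} e refl = trans (restore a b) (trans (cong (_+ b) e) (sym (restore c b)))
    where
    restore : ∀ a b → a ≡ (a - b) + b
    restore = solve-∀
  raise : ∀ n r → coeff (i ∷ replicate n j ++ r) (j ◃ P) ≡ coeff (i ∷ replicate n j ++ r) (j ◃ Q) →
    coeff (replicate n j ++ r) P ≡ coeff (replicate n j ++ r) Q
  raise n r e = solve
    (subst₂ (λ a b → a - coeff (i ∷ replicate n j ++ r) (j ◃ P) ≡ b - coeff (i ∷ replicate n j ++ r) (j ◃ Q))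
      (coeff-◃-∷ i _ P) (coeff-◃-∷ i _ Q) (eq (i ∷ replicate n j ++ r)))
    e
  j∉i∷ : ∀ {r} → j ∉ r → j ∉ i ∷ r
  j∉i∷ j∉r (here e)  = i≢j (sym e)
  j∉i∷ j∉r (there q) = j∉r q
  go : ∀ n r → j ∉ r → coeff (replicate n j ++ r) P ≡ coeff (replicate n j ++ r) Q
  go zero    r j∉r = raise zero r (trans (coeff-◃-∉ P (j∉i∷ j∉r)) (sym (coeff-◃-∉ Q (j∉i∷ j∉r))))
  go (suc n) r j∉r = raise (suc n) r
    (trans (lower P) (trans (go n (i ∷ r) (j∉i∷ j∉r)) (sym (lower Q))))
    where
    lower : ∀ R → coeff (i ∷ j ∷ replicate n j ++ r) (j ◃ R) ≡ coeff (replicate n j ++ i ∷ r) R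
    lower R = trans (coeff-resp-↭ (j ◃ R) (swap i j ↭-refl))
      (trans (coeff-◃-∷ j _ R) (coeff-resp-↭ R (↭-sym (shift i (replicate n j) r))))

coeff-[xᵢ-xᵢ₊₁]∂ : ∀ i P m →
  coeff m (i ◃ ∂ i P) - coeff m (suc i ◃ ∂ i P) ≡ coeff m P - coeff m (s i ▷ P)
coeff-[xᵢ-xᵢ₊₁]∂ i P m = begin
  coeff m (i ◃ ∂ i P) - coeff m (suc i ◃ ∂ i P)
    ≡⟨ cong₂ _+_ (coeff-x i (∂ i P) m) (trans (coeff-x* -1ℤ (suc i) (∂ i P) m) (ℤ.-1*i≡-i _)) ⟨
  coeff m (x i *ₚ ∂ i P) + coeff m (mono -1ℤ (suc i ∷ []) *ₚ ∂ i P)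
    ≡⟨ cong (λ Q → coeff m Q + coeff m (mono -1ℤ (suc i ∷ []) *ₚ ∂ i P)) (++-identityʳ (map (zip _*_ _++_ (1ℤ , i ∷ [])) (∂ i P))) ⟩
  coeff m (map (zip _*_ _++_ (1ℤ , i ∷ [])) (∂ i P)) + coeff m (mono -1ℤ (suc i ∷ []) *ₚ ∂ i P)
    ≡⟨ coeff-++ m (map (zip _*_ _++_ (1ℤ , i ∷ [])) (∂ i P)) _ ⟨
  coeff m ((x i -ₚ x (suc i)) *ₚ ∂ i P)
    ≡⟨ ∂-quotient i P m ⟩
  coeff m (P -ₚ s i ▷ P)
    ≡⟨ coeff-- P (s i ▷ P) m ⟩
  coeff m P - coeff m (s i ▷ P) ∎
  where open ≡-Reasoning

-- `∂` is computed term by term on a representative, so invariance is not visible from its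
-- definition. It holds because (x_i - x_{i+1}) ∂_i P = P - s_i P depends on the class of P only and
-- x_i - x_{i+1} can be cancelled.
∂-cong : ∀ i {P Q} → P ≈ₚ Q → ∂ i P ≈ₚ ∂ i Q
∂-cong i {P} {Q} P≈Q = ◃-cancel i (suc i) {∂ i P} {∂ i Q} (ℕ.m≢1+n+m i {0}) λ m →
  trans (coeff-[xᵢ-xᵢ₊₁]∂ i P m)
    (trans (cong₂ _-_ (P≈Q m) (▷-cong (s i) {P} {Q} P≈Q m)) (sym (coeff-[xᵢ-xᵢ₊₁]∂ i Q m)))

-- The Leibniz rule for x_k P, linear in P and built into `∂-monomial` for a single monomial. It
-- justifies the clause of `τ` for `k ⊙ A`.
coeff-∂-◃ : ∀ i k P m →
  coeff m (∂ i (k ◃ P)) ≡ ∂-variable i k * coeff m P + coeff m (transposition i k ◃ ∂ i P)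
coeff-∂-◃ i k []            m = sym (trans (ℤ.+-identityʳ _) (ℤ.*-zeroʳ (∂-variable i k)))
coeff-∂-◃ i k ((c , a) ∷ P) m = begin
  coeff m (c · (mono α a ++ x tk *ₚ ∂a) ++ ∂ i (k ◃ P))
    ≡⟨ coeff-++ m (c · (mono α a ++ x tk *ₚ ∂a)) (∂ i (k ◃ P)) ⟩
  coeff m (c · (mono α a ++ x tk *ₚ ∂a)) + coeff m (∂ i (k ◃ P))
    ≡⟨ cong₂ _+_ (coeff-· c (mono α a ++ x tk *ₚ ∂a) m) (coeff-∂-◃ i k P m) ⟩
  c * coeff m (mono α a ++ x tk *ₚ ∂a) + (α * coeff m P + coeff m (tk ◃ ∂ i P))
    ≡⟨ cong (λ z → c * z + (α * coeff m P + coeff m (tk ◃ ∂ i P)))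
         (trans (coeff-++ m (mono α a) (x tk *ₚ ∂a)) (cong₂ _+_ (single α) (coeff-x tk ∂a m))) ⟩
  c * (α * δ + coeff m (tk ◃ ∂a)) + (α * coeff m P + coeff m (tk ◃ ∂ i P))
    ≡⟨ rearrange c α δ (coeff m (tk ◃ ∂a)) (coeff m P) (coeff m (tk ◃ ∂ i P)) ⟩
  α * (c * δ + coeff m P) + (c * coeff m (tk ◃ ∂a) + coeff m (tk ◃ ∂ i P))
    ≡⟨ cong₂ (λ y z → α * y + z) (cong (_+ coeff m P) (trans (sym (if-* (does (m ↭? a)) c 1ℤ)) (cong (λ z → if does (m ↭? a) then z else 0ℤ) (ℤ.*-identityʳ c)))) ◃-split ⟩
  α * coeff m ((c , a) ∷ P) + coeff m (tk ◃ ∂ i ((c , a) ∷ P)) ∎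
  where
  open ≡-Reasoning
  α = ∂-variable i k
  tk = transposition i k
  ∂a = ∂-monomial i a
  δ = if does (m ↭? a) then 1ℤ else 0ℤ
  single : ∀ d → coeff m (mono d a) ≡ d * δ
  single d = trans (ℤ.+-identityʳ _) (trans (cong (λ z → if does (m ↭? a) then z else 0ℤ) (sym (ℤ.*-identityʳ d))) (if-* (does (m ↭? a)) d 1ℤ))
  rearrange : ∀ c α d y p q → c * (α * d + y) + (α * p + q) ≡ α * (c * d + p) + (c * y + q)
  rearrange = solve-∀
  ◃-· : ∀ Q → tk ◃ (c · Q) ≡ c · (tk ◃ Q)
  ◃-· Q = trans (sym (map-∘ Q)) (map-∘ Q)
  ◃-split : c * coeff m (tk ◃ ∂a) + coeff m (tk ◃ ∂ i P) ≡ coeff m (tk ◃ (c · ∂a ++ ∂ i P))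
  ◃-split = sym (trans (cong (coeff m) (map-++ _ (c · ∂a) (∂ i P)))
    (trans (coeff-++ m (tk ◃ (c · ∂a)) (tk ◃ ∂ i P))
      (cong (_+ coeff m (tk ◃ ∂ i P)) (trans (cong (coeff m) (◃-· ∂a)) (coeff-· c (tk ◃ ∂a) m)))))

-- The nilCoxeter action

transposition-i : ∀ i → transposition i i ≡ suc i
transposition-i zero    = refl
transposition-i (suc i) = cong suc (transposition-i i)

transposition-1+i : ∀ i → transposition i (suc i) ≡ i
transposition-1+i zero    = refl
transposition-1+i (suc i) = cong suc (transposition-1+i i)

transposition-other : ∀ {i j} → j ≢ i → j ≢ suc i → transposition i j ≡ j
transposition-other {zero}  {zero}        j≢i _ = contradiction refl j≢i
transposition-other {zero}  {suc zero}    _ j≢1 = contradiction refl j≢1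
transposition-other {zero}  {suc (suc j)} _ _   = refl
transposition-other {suc i} {zero}        _ _   = refl
transposition-other {suc i} {suc j}       p q   = cong suc (transposition-other (p ∘ cong suc) (q ∘ cong suc))

transposition-1+i-i : ∀ i → transposition (suc i) i ≡ i
transposition-1+i-i i = transposition-other (ℕ.<⇒≢ (ℕ.n<1+n i)) (ℕ.<⇒≢ (ℕ.m≤n⇒m≤1+n (ℕ.n<1+n i)))

transposition-far : ∀ i j k → suc i < j →
  transposition i (transposition j k) ≡ transposition j (transposition i k)
transposition-far zero    (suc (suc j)) zero          _         = refl
transposition-far zero    (suc (suc j)) (suc zero)    _         = refl
transposition-far zero    (suc (suc j)) (suc (suc k)) _         = refl
transposition-far zero    (suc zero)    _             (s≤s ())
transposition-far (suc i) (suc j)       zero          _         = refl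
transposition-far (suc i) (suc j)       (suc k)       (s≤s i<j) = cong suc (transposition-far i j k i<j)

transposition-braid : ∀ i k →
  transposition i (transposition (suc i) (transposition i k)) ≡
  transposition (suc i) (transposition i (transposition (suc i) k))
transposition-braid zero    zero                = refl
transposition-braid zero    (suc zero)          = refl
transposition-braid zero    (suc (suc zero))    = refl
transposition-braid zero    (suc (suc (suc k))) = refl
transposition-braid (suc i) zero                = refl
transposition-braid (suc i) (suc k)             = cong suc (transposition-braid i k)

∂-variable-i : ∀ i → ∂-variable i i ≡ 1ℤ
∂-variable-i zero    = refl
∂-variable-i (suc i) = ∂-variable-i i

∂-variable-other : ∀ {i j} → j ≢ i → j ≢ suc i → ∂-variable i j ≡ 0ℤ
∂-variable-other {zero}  {zero}        j≢i _ = contradiction refl j≢i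
∂-variable-other {zero}  {suc zero}    _ j≢1 = contradiction refl j≢1
∂-variable-other {zero}  {suc (suc j)} _ _   = refl
∂-variable-other {suc i} {zero}        _ _   = refl
∂-variable-other {suc i} {suc j}       p q   = ∂-variable-other {i} {j} (p ∘ cong suc) (q ∘ cong suc)

∂-variable-1+i : ∀ i → ∂-variable i (suc i) ≡ -1ℤ
∂-variable-1+i zero    = refl
∂-variable-1+i (suc i) = ∂-variable-1+i i

-- `∂-variable i k` is the k-th coordinate of the simple root e_i - e_{i+1}, which s_i negates.
∂-variable-alternating : ∀ i k → ∂-variable i (transposition i k) ≡ - ∂-variable i k
∂-variable-alternating zero    zero          = refl
∂-variable-alternating zero    (suc zero)    = refl
∂-variable-alternating zero    (suc (suc k)) = refl
∂-variable-alternating (suc i) zero          = refl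
∂-variable-alternating (suc i) (suc k)       = ∂-variable-alternating i k

∂-variable-far : ∀ i j k → suc i < j → ∂-variable i (transposition j k) ≡ ∂-variable i k
∂-variable-far zero    (suc (suc j)) zero          _         = refl
∂-variable-far zero    (suc (suc j)) (suc zero)    _         = refl
∂-variable-far zero    (suc (suc j)) (suc (suc k)) _         = refl
∂-variable-far zero    (suc zero)    _             (s≤s ())
∂-variable-far (suc i) (suc j)       zero          _         = refl
∂-variable-far (suc i) (suc j)       (suc k)       (s≤s i<j) = ∂-variable-far i j k i<j

∂-variable-far′ : ∀ i j k → suc i < j → ∂-variable j (transposition i k) ≡ ∂-variable j k
∂-variable-far′ zero    (suc (suc j)) zero          _         = refl
∂-variable-far′ zero    (suc (suc j)) (suc zero)    _         = refl
∂-variable-far′ zero    (suc (suc j)) (suc (suc k)) _         = refl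
∂-variable-far′ zero    (suc zero)    _             (s≤s ())
∂-variable-far′ (suc i) (suc j)       zero          _         = refl
∂-variable-far′ (suc i) (suc j)       (suc k)       (s≤s i<j) = ∂-variable-far′ i j k i<j

-- In terms of roots: s_i s_{i+1} sends e_i - e_{i+1} to e_{i+1} - e_{i+2}.
∂-variable-braid : ∀ i k → ∂-variable i (transposition (suc i) (transposition i k)) ≡ ∂-variable (suc i) k
∂-variable-braid zero    zero                = refl
∂-variable-braid zero    (suc zero)          = refl
∂-variable-braid zero    (suc (suc zero))    = refl
∂-variable-braid zero    (suc (suc (suc k))) = refl
∂-variable-braid (suc i) zero                = refl
∂-variable-braid (suc i) (suc k)             = ∂-variable-braid i k

∂-variable-braid′ : ∀ i k → ∂-variable (suc i) (transposition i (transposition (suc i) k)) ≡ ∂-variable i k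
∂-variable-braid′ zero    zero                = refl
∂-variable-braid′ zero    (suc zero)          = refl
∂-variable-braid′ zero    (suc (suc zero))    = refl
∂-variable-braid′ zero    (suc (suc (suc k))) = refl
∂-variable-braid′ (suc i) zero                = refl
∂-variable-braid′ (suc i) (suc k)             = ∂-variable-braid′ i k

-- Polynomials whose coefficients are functions on S∞, as expressions; k ⊙ A
-- is x_k A.  A function f : S∞ → ℤ stands for Σ_u f(u) u.
infixr 6 _⊕_
infixr 7 _⊙_

data Element : Set where
  const : (f : S∞ → ℤ) → (∀ u v → u ≈ v → f u ≡ f v) → Element
  _⊕_   : Element → Element → Element
  _⊙_   : ℕ → Element → Element

⟦_⟧ : Element → S∞ → Poly
⟦ const f _ ⟧ v = mono (f v) []
⟦ A ⊕ B     ⟧ v = ⟦ A ⟧ v +ₚ ⟦ B ⟧ v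
⟦ k ⊙ A     ⟧ v = k ◃ ⟦ A ⟧ v

infix 4 _≋_
-- A record, not a function type, so that both elements can be inferred from a proof.
record _≋_ (A B : Element) : Set where
  constructor mk≋
  field at : ∀ v → ⟦ A ⟧ v ≈ₚ ⟦ B ⟧ v
open _≋_

≋-setoid : Setoid _ _
≋-setoid = record
  { Carrier = Element
  ; _≈_ = _≋_
  ; isEquivalence = record
    { refl = mk≋ λ _ _ → refl
    ; sym = λ p → mk≋ λ v m → sym (at p v m)
    ; trans = λ p q → mk≋ λ v m → trans (at p v m) (at q v m)
    }
  }

open Setoid ≋-setoid using () renaming (refl to ≋-refl; sym to ≋-sym; trans to ≋-trans; reflexive to ≋-reflexive)
module ≋-Reasoning = Relation.Binary.Reasoning.Setoid ≋-setoid

𝟘 : Element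
𝟘 = const (λ _ → 0ℤ) (λ _ _ _ → refl)

scale : ℤ → Element → Element
scale z (const f f-cong) = const (λ v → z * f v) (λ u v u≈v → cong (z *_) (f-cong u v u≈v))
scale z (A ⊕ B)          = scale z A ⊕ scale z B
scale z (k ⊙ A)          = k ⊙ scale z A

ascends : S∞ → ℕ → Bool
ascends v i = does (to v i ℕ.<? to v (suc i))

raise : ℕ → (S∞ → ℤ) → S∞ → ℤ
raise i f v = if ascends v i then f (v ∙ s i) else 0ℤ

raise-cong : ∀ i {f} → (∀ u v → u ≈ v → f u ≡ f v) → ∀ u v → u ≈ v → raise i f u ≡ raise i f v
raise-cong i {f} f-cong u v u≈v = trans
  (if-cong (cong₂ (λ a b → does (a ℕ.<? b)) (u≈v i) (u≈v (suc i))))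
  (cong (λ z → if ascends v i then z else 0ℤ) (f-cong (u ∙ s i) (v ∙ s i) (λ j → u≈v (transposition i j))))

-- The element s_i of the nilCoxeter algebra acting by the generalized
-- Leibniz rule: (τ i A)(v) = ∂_i (A(v)) + s_i (A(v s_i)), where the second
-- term is present only if v < v s_i.  The recurrence for ∂_u^w is the
-- transpose of this.
τ : ℕ → Element → Element
τ i (const f f-cong) = const (raise i f) (raise-cong i f-cong)
τ i (A ⊕ B)          = τ i A ⊕ τ i B
τ i (k ⊙ A)          = scale (∂-variable i k) A ⊕ transposition i k ⊙ τ i A

coeff-mono-0 : ∀ m → coeff m (mono 0ℤ []) ≡ 0ℤ
coeff-mono-0 []      = refl
coeff-mono-0 (_ ∷ _) = refl

coeff-mono : ∀ m z → coeff m (mono z []) ≡ z * coeff m 1ₚ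
coeff-mono []      z = lemma z
  where
  lemma : ∀ z → z + 0ℤ ≡ z * 1ℤ
  lemma = solve-∀
coeff-mono (_ ∷ _) z = sym (ℤ.*-zeroʳ z)

coeff-scale : ∀ z A v m → coeff m (⟦ scale z A ⟧ v) ≡ z * coeff m (⟦ A ⟧ v)
coeff-scale z (const f _) v m = trans (coeff-mono m (z * f v))
  (trans (ℤ.*-assoc z (f v) _) (cong (z *_) (sym (coeff-mono m (f v)))))
coeff-scale z (A ⊕ B) v m = begin
  coeff m (⟦ scale z A ⟧ v ++ ⟦ scale z B ⟧ v)               ≡⟨ coeff-++ m (⟦ scale z A ⟧ v) _ ⟩
  coeff m (⟦ scale z A ⟧ v) + coeff m (⟦ scale z B ⟧ v)      ≡⟨ cong₂ _+_ (coeff-scale z A v m) (coeff-scale z B v m) ⟩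
  z * coeff m (⟦ A ⟧ v) + z * coeff m (⟦ B ⟧ v)              ≡⟨ ℤ.*-distribˡ-+ z _ _ ⟨
  z * (coeff m (⟦ A ⟧ v) + coeff m (⟦ B ⟧ v))                ≡⟨ cong (z *_) (coeff-++ m (⟦ A ⟧ v) _) ⟨
  z * coeff m (⟦ A ⟧ v ++ ⟦ B ⟧ v)                           ∎
  where open ≡-Reasoning
coeff-scale z (k ⊙ A) v m = begin
  coeff m (k ◃ ⟦ scale z A ⟧ v)  ≡⟨ ◃-cong k {⟦ scale z A ⟧ v} {z · ⟦ A ⟧ v} (λ n → trans (coeff-scale z A v n) (sym (coeff-· z (⟦ A ⟧ v) n))) m ⟩
  coeff m (k ◃ (z · ⟦ A ⟧ v))    ≡⟨ cong (coeff m) (trans (sym (map-∘ (⟦ A ⟧ v))) (map-∘ (⟦ A ⟧ v))) ⟩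
  coeff m (z · (k ◃ ⟦ A ⟧ v))    ≡⟨ coeff-· z (k ◃ ⟦ A ⟧ v) m ⟩
  z * coeff m (k ◃ ⟦ A ⟧ v)      ∎
  where open ≡-Reasoning

coeff-⊕ : ∀ A B v m → coeff m (⟦ A ⊕ B ⟧ v) ≡ coeff m (⟦ A ⟧ v) + coeff m (⟦ B ⟧ v)
coeff-⊕ A B v m = coeff-++ m (⟦ A ⟧ v) (⟦ B ⟧ v)

moved : ℕ → Element → S∞ → Poly
moved i A v = if ascends v i then s i ▷ ⟦ A ⟧ (v ∙ s i) else 0ₚ

-- The right side mentions A only through its values, so `τ`, although defined by recursion on
-- expressions, acts on the functions that they denote.
⟦τ⟧ : ∀ i A v → ⟦ τ i A ⟧ v ≈ₚ ∂ i (⟦ A ⟧ v) +ₚ moved i A v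
⟦τ⟧ i (const f _) v m with ascends v i
... | true  = refl
... | false = coeff-mono-0 m
⟦τ⟧ i (A ⊕ B) v m = begin
  coeff m (⟦ τ i A ⟧ v ++ ⟦ τ i B ⟧ v)
    ≡⟨ coeff-++ m (⟦ τ i A ⟧ v) _ ⟩
  coeff m (⟦ τ i A ⟧ v) + coeff m (⟦ τ i B ⟧ v)
    ≡⟨ cong₂ _+_ (trans (⟦τ⟧ i A v m) (coeff-++ m (∂ i (⟦ A ⟧ v)) _)) (trans (⟦τ⟧ i B v m) (coeff-++ m (∂ i (⟦ B ⟧ v)) _)) ⟩
  (coeff m (∂ i (⟦ A ⟧ v)) + coeff m (moved i A v)) + (coeff m (∂ i (⟦ B ⟧ v)) + coeff m (moved i B v))
    ≡⟨ interchange (coeff m (∂ i (⟦ A ⟧ v))) (coeff m (moved i A v)) (coeff m (∂ i (⟦ B ⟧ v))) (coeff m (moved i B v)) ⟩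
  (coeff m (∂ i (⟦ A ⟧ v)) + coeff m (∂ i (⟦ B ⟧ v))) + (coeff m (moved i A v) + coeff m (moved i B v))
    ≡⟨ cong₂ _+_ (trans (cong (coeff m) (concatMap-++ _ (⟦ A ⟧ v) (⟦ B ⟧ v))) (coeff-++ m (∂ i (⟦ A ⟧ v)) _)) moved-⊕ ⟨
  coeff m (∂ i (⟦ A ⊕ B ⟧ v)) + coeff m (moved i (A ⊕ B) v)
    ≡⟨ coeff-++ m (∂ i (⟦ A ⊕ B ⟧ v)) _ ⟨
  coeff m (∂ i (⟦ A ⊕ B ⟧ v) +ₚ moved i (A ⊕ B) v) ∎
  where
  open ≡-Reasoning
  interchange : ∀ a b c d → (a + b) + (c + d) ≡ (a + c) + (b + d)
  interchange = solve-∀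
  moved-⊕ : coeff m (moved i (A ⊕ B) v) ≡ coeff m (moved i A v) + coeff m (moved i B v)
  moved-⊕ with ascends v i
  ... | true  = trans (cong (coeff m) (map-++ _ (⟦ A ⟧ (v ∙ s i)) _)) (coeff-++ m (s i ▷ ⟦ A ⟧ (v ∙ s i)) _)
  ... | false = refl
⟦τ⟧ i (k ⊙ A) v m = begin
  coeff m (⟦ scale α A ⟧ v ++ tk ◃ ⟦ τ i A ⟧ v)
    ≡⟨ coeff-++ m (⟦ scale α A ⟧ v) _ ⟩
  coeff m (⟦ scale α A ⟧ v) + coeff m (tk ◃ ⟦ τ i A ⟧ v)
    ≡⟨ cong₂ _+_ (coeff-scale α A v m) (trans (◃-cong tk {⟦ τ i A ⟧ v} {∂ i (⟦ A ⟧ v) +ₚ moved i A v} (⟦τ⟧ i A v) m) ◃-++) ⟩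
  α * coeff m (⟦ A ⟧ v) + (coeff m (tk ◃ ∂ i (⟦ A ⟧ v)) + coeff m (tk ◃ moved i A v))
    ≡⟨ ℤ.+-assoc (α * coeff m (⟦ A ⟧ v)) (coeff m (tk ◃ ∂ i (⟦ A ⟧ v))) (coeff m (tk ◃ moved i A v)) ⟨
  (α * coeff m (⟦ A ⟧ v) + coeff m (tk ◃ ∂ i (⟦ A ⟧ v))) + coeff m (tk ◃ moved i A v)
    ≡⟨ cong₂ _+_ (sym (coeff-∂-◃ i k (⟦ A ⟧ v) m)) moved-⊙ ⟩
  coeff m (∂ i (k ◃ ⟦ A ⟧ v)) + coeff m (moved i (k ⊙ A) v)
    ≡⟨ coeff-++ m (∂ i (k ◃ ⟦ A ⟧ v)) _ ⟨
  coeff m (∂ i (k ◃ ⟦ A ⟧ v) +ₚ moved i (k ⊙ A) v) ∎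
  where
  open ≡-Reasoning
  α = ∂-variable i k
  tk = transposition i k
  ◃-++ : coeff m (tk ◃ (∂ i (⟦ A ⟧ v) +ₚ moved i A v)) ≡ coeff m (tk ◃ ∂ i (⟦ A ⟧ v)) + coeff m (tk ◃ moved i A v)
  ◃-++ = trans (cong (coeff m) (map-++ _ (∂ i (⟦ A ⟧ v)) _)) (coeff-++ m (tk ◃ ∂ i (⟦ A ⟧ v)) _)
  moved-⊙ : coeff m (tk ◃ moved i A v) ≡ coeff m (moved i (k ⊙ A) v)
  moved-⊙ with ascends v i
  ... | true  = cong (coeff m) (sym (▷-◃ (s i) k (⟦ A ⟧ (v ∙ s i))))
  ... | false = refl

⊕-cong : ∀ {A A′ B B′} → A ≋ A′ → B ≋ B′ → A ⊕ B ≋ A′ ⊕ B′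
⊕-cong {A} {A′} {B} {B′} p q = mk≋ λ v m → trans (coeff-⊕ A B v m)
  (trans (cong₂ _+_ (at p v m) (at q v m)) (sym (coeff-⊕ A′ B′ v m)))

⊙-cong : ∀ k {A B} → A ≋ B → k ⊙ A ≋ k ⊙ B
⊙-cong k {A} {B} p = mk≋ λ v → ◃-cong k {⟦ A ⟧ v} {⟦ B ⟧ v} (at p v)

⊙-comm : ∀ j k A → j ⊙ k ⊙ A ≋ k ⊙ j ⊙ A
⊙-comm j k A = mk≋ λ v → ◃-comm j k (⟦ A ⟧ v)

scale-cong : ∀ z {A B} → A ≋ B → scale z A ≋ scale z B
scale-cong z {A} {B} p = mk≋ λ v m → trans (coeff-scale z A v m)
  (trans (cong (z *_) (at p v m)) (sym (coeff-scale z B v m)))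

scale-0 : ∀ A → scale 0ℤ A ≋ 𝟘
scale-0 A = mk≋ λ v m → trans (coeff-scale 0ℤ A v m) (sym (coeff-mono-0 m))

scale-1 : ∀ A → scale 1ℤ A ≋ A
scale-1 A = mk≋ λ v m → trans (coeff-scale 1ℤ A v m) (ℤ.*-identityˡ _)

⊕-identityˡ : ∀ A → 𝟘 ⊕ A ≋ A
⊕-identityˡ A = mk≋ λ v m → trans (coeff-⊕ 𝟘 A v m)
  (trans (cong (_+ coeff m (⟦ A ⟧ v)) (coeff-mono-0 m)) (ℤ.+-identityˡ _))

τ-cong : ∀ i {A B} → A ≋ B → τ i A ≋ τ i B
τ-cong i {A} {B} p = mk≋ λ v m → trans (⟦τ⟧ i A v m)
  (trans (coeff-++ m (∂ i (⟦ A ⟧ v)) _)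
    (trans (cong₂ _+_ (∂-cong i {⟦ A ⟧ v} {⟦ B ⟧ v} (at p v) m) (moved-cong v m))
      (trans (sym (coeff-++ m (∂ i (⟦ B ⟧ v)) _)) (sym (⟦τ⟧ i B v m)))))
  where
  moved-cong : ∀ v → moved i A v ≈ₚ moved i B v
  moved-cong v m with ascends v i
  ... | true  = ▷-cong (s i) {⟦ A ⟧ (v ∙ s i)} {⟦ B ⟧ (v ∙ s i)} (at p (v ∙ s i)) m
  ... | false = refl

const-cong : ∀ {f g} {f-cong : ∀ u v → u ≈ v → f u ≡ f v} {g-cong : ∀ u v → u ≈ v → g u ≡ g v} →
  (∀ v → f v ≡ g v) → const f f-cong ≋ const g g-cong
const-cong e = mk≋ λ v m → cong (λ z → coeff m (mono z [])) (e v)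

⊙-𝟘 : ∀ k → k ⊙ 𝟘 ≋ 𝟘
-- `scale 0ℤ (k ⊙ 𝟘)` and `k ⊙ 𝟘` evaluate to the same list, because 0 * 0 computes to 0.
⊙-𝟘 k = mk≋ (at (scale-0 (k ⊙ 𝟘)))

τ-𝟘 : ∀ i → τ i 𝟘 ≋ 𝟘
τ-𝟘 i = const-cong λ v → if-same (ascends v i)
  where
  if-same : ∀ b → (if b then 0ℤ else 0ℤ) ≡ 0ℤ
  if-same true  = refl
  if-same false = refl

τ-scale : ∀ i z A → τ i (scale z A) ≋ scale z (τ i A)
τ-scale i z (const f _) = const-cong λ v → if-* (ascends v i) z (f (v ∙ s i))
τ-scale i z (A ⊕ B)     = ⊕-cong (τ-scale i z A) (τ-scale i z B)
τ-scale i z (k ⊙ A)     = ⊕-cong swap-scales (⊙-cong (transposition i k) (τ-scale i z A))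
  where
  α = ∂-variable i k
  lemma : ∀ a z y → a * (z * y) ≡ z * (a * y)
  lemma = solve-∀
  swap-scales : scale α (scale z A) ≋ scale z (scale α A)
  swap-scales = mk≋ λ v m → begin
    coeff m (⟦ scale α (scale z A) ⟧ v)  ≡⟨ trans (coeff-scale α (scale z A) v m) (cong (α *_) (coeff-scale z A v m)) ⟩
    α * (z * coeff m (⟦ A ⟧ v))          ≡⟨ lemma α z (coeff m (⟦ A ⟧ v)) ⟩
    z * (α * coeff m (⟦ A ⟧ v))          ≡⟨ trans (coeff-scale z (scale α A) v m) (cong (z *_) (coeff-scale α A v m)) ⟨
    coeff m (⟦ scale z (scale α A) ⟧ v)  ∎
    where open ≡-Reasoning

-- Brings x_k to the front. In the relations below, the last summand is then settled by the
-- induction hypothesis for A, and the others by comparing coefficients `∂-variable`.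
ττ-⊙ : ∀ i j k A → τ i (τ j (k ⊙ A)) ≋
  scale (∂-variable j k) (τ i A) ⊕
  scale (∂-variable i (transposition j k)) (τ j A) ⊕
  transposition i (transposition j k) ⊙ τ i (τ j A)
ττ-⊙ i j k A = ⊕-cong (τ-scale i (∂-variable j k) A) ≋-refl

τττ-⊙ : ∀ h i j k A → τ h (τ i (τ j (k ⊙ A))) ≋
  scale (∂-variable j k) (τ h (τ i A)) ⊕
  scale (∂-variable i (transposition j k)) (τ h (τ j A)) ⊕
  scale (∂-variable h (transposition i (transposition j k))) (τ i (τ j A)) ⊕
  transposition h (transposition i (transposition j k)) ⊙ τ h (τ i (τ j A))
τττ-⊙ h i j k A = ≋-trans (τ-cong h (ττ-⊙ i j k A))
  (⊕-cong (τ-scale h _ (τ i A)) (⊕-cong (τ-scale h _ (τ j A)) ≋-refl))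

ascends-s : ∀ v i → ascends (v ∙ s i) i ≡ does (to v (suc i) ℕ.<? to v i)
ascends-s v i = cong₂ (λ a b → does (to v a ℕ.<? to v b)) (transposition-i i) (transposition-1+i i)

-- For constants, v < v s_i and v s_i < v cannot both hold. For x_k A, the two terms with a single
-- τ_i cancel because s_i negates its own root.
τ-nilpotent : ∀ i A → τ i (τ i A) ≋ 𝟘
τ-nilpotent i (const f _) = const-cong vanishes
  where
  vanishes : ∀ v → raise i (raise i f) v ≡ 0ℤ
  vanishes v with to v i ℕ.<? to v (suc i)
  ... | no ¬p = if-cong (dec-false (to v i ℕ.<? to v (suc i)) ¬p)
  ... | yes p = trans (if-cong (dec-true (to v i ℕ.<? to v (suc i)) p))
    (if-cong (trans (ascends-s v i) (dec-false (to v (suc i) ℕ.<? to v i) (ℕ.<-asym p))))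
τ-nilpotent i (A ⊕ B) = ≋-trans (⊕-cong (τ-nilpotent i A) (τ-nilpotent i B)) (⊕-identityˡ 𝟘)
τ-nilpotent i (k ⊙ A) = ≋-trans (ττ-⊙ i i k A) (≋-trans (⊕-cong ≋-refl (⊕-cong ≋-refl
  (≋-trans (⊙-cong _ (τ-nilpotent i A)) (⊙-𝟘 _)))) (mk≋ cancels))
  where
  α = ∂-variable i k
  lemma : ∀ a y → a * y + (- a * y + 0ℤ) ≡ 0ℤ
  lemma = solve-∀
  β = ∂-variable i (transposition i k)
  cancels : ∀ v → ⟦ scale α (τ i A) ⊕ scale β (τ i A) ⊕ 𝟘 ⟧ v ≈ₚ ⟦ 𝟘 ⟧ v
  cancels v m = begin
    coeff m (⟦ scale α (τ i A) ⊕ scale β (τ i A) ⊕ 𝟘 ⟧ v)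
      ≡⟨ trans (coeff-⊕ (scale α (τ i A)) (scale β (τ i A) ⊕ 𝟘) v m) (cong₂ _+_ (coeff-scale α (τ i A) v m) (trans (coeff-⊕ (scale β (τ i A)) 𝟘 v m) (cong₂ _+_ (coeff-scale β (τ i A) v m) (coeff-mono-0 m)))) ⟩
    α * y + (β * y + 0ℤ)
      ≡⟨ cong (λ b → α * y + (b * y + 0ℤ)) (∂-variable-alternating i k) ⟩
    α * y + (- α * y + 0ℤ)
      ≡⟨ lemma α y ⟩
    0ℤ
      ≡⟨ coeff-mono-0 m ⟨
    coeff m (⟦ 𝟘 ⟧ v) ∎
    where
    open ≡-Reasoning
    y = coeff m (⟦ τ i A ⟧ v)

if-swap : ∀ a b (z : ℤ) → (if a then (if b then z else 0ℤ) else 0ℤ) ≡ (if b then (if a then z else 0ℤ) else 0ℤ)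
if-swap true  true  z = refl
if-swap true  false z = refl
if-swap false true  z = refl
if-swap false false z = refl

ascends-far : ∀ v i j → suc i < j → ascends (v ∙ s i) j ≡ ascends v j
ascends-far v i j i<j = cong₂ (λ a b → does (to v a ℕ.<? to v b))
  (transposition-fixes i j i<j) (transposition-fixes i (suc j) (ℕ.m≤n⇒m≤1+n i<j))

ascends-far′ : ∀ v i j → suc i < j → ascends (v ∙ s j) i ≡ ascends v i
ascends-far′ v i j i<j = cong₂ (λ a b → does (to v a ℕ.<? to v b))
  (transposition-other (ℕ.<⇒≢ (ℕ.<-trans (ℕ.n<1+n i) i<j)) (ℕ.<⇒≢ (ℕ.m≤n⇒m≤1+n (ℕ.<-trans (ℕ.n<1+n i) i<j))))
  (transposition-other (ℕ.<⇒≢ i<j) (ℕ.<⇒≢ (ℕ.m≤n⇒m≤1+n i<j)))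

τ-far : ∀ {i j} → suc i < j → ∀ A → τ i (τ j A) ≋ τ j (τ i A)
τ-far {i} {j} i<j (const f f-cong) = const-cong λ v → begin
  raise i (raise j f) v
    ≡⟨ cong (λ b → if ascends v i then (if b then f (v ∙ s i ∙ s j) else 0ℤ) else 0ℤ) (ascends-far v i j i<j) ⟩
  (if ascends v i then (if ascends v j then f (v ∙ s i ∙ s j) else 0ℤ) else 0ℤ)
    ≡⟨ cong (λ z → if ascends v i then (if ascends v j then z else 0ℤ) else 0ℤ)
         (f-cong _ _ λ k → cong (to v) (transposition-far i j k i<j)) ⟩
  (if ascends v i then (if ascends v j then f (v ∙ s j ∙ s i) else 0ℤ) else 0ℤ)
    ≡⟨ if-swap (ascends v i) (ascends v j) _ ⟩
  (if ascends v j then (if ascends v i then f (v ∙ s j ∙ s i) else 0ℤ) else 0ℤ)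
    ≡⟨ cong (λ b → if ascends v j then (if b then f (v ∙ s j ∙ s i) else 0ℤ) else 0ℤ) (ascends-far′ v i j i<j) ⟨
  raise j (raise i f) v ∎
  where open ≡-Reasoning
τ-far i<j (A ⊕ B) = ⊕-cong (τ-far i<j A) (τ-far i<j B)
τ-far {i} {j} i<j (k ⊙ A)
  = ≋-trans (ττ-⊙ i j k A)
    (≋-trans (⊕-cong ≋-refl (⊕-cong ≋-refl (⊙-cong _ (τ-far i<j A))))
      (≋-trans (mk≋ exchange) (≋-sym (ττ-⊙ j i k A))))
  where
  lemma : ∀ a b c → a + (b + c) ≡ b + (a + c)
  lemma = solve-∀
  exchange : ∀ v → ⟦ scale (∂-variable j k) (τ i A) ⊕ scale (∂-variable i (transposition j k)) (τ j A) ⊕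
                     transposition i (transposition j k) ⊙ τ j (τ i A) ⟧ v ≈ₚ
                   ⟦ scale (∂-variable i k) (τ j A) ⊕ scale (∂-variable j (transposition i k)) (τ i A) ⊕
                     transposition j (transposition i k) ⊙ τ j (τ i A) ⟧ v
  exchange v m
    rewrite ∂-variable-far i j k i<j | ∂-variable-far′ i j k i<j | transposition-far i j k i<j
    = trans (trans (coeff-⊕ X (Y ⊕ Z) v m) (cong (coeff m (⟦ X ⟧ v) +_) (coeff-⊕ Y Z v m)))
      (trans (lemma (coeff m (⟦ X ⟧ v)) (coeff m (⟦ Y ⟧ v)) (coeff m (⟦ Z ⟧ v)))
        (sym (trans (coeff-⊕ Y (X ⊕ Z) v m) (cong (coeff m (⟦ Y ⟧ v) +_) (coeff-⊕ X Z v m)))))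
    where
    X = scale (∂-variable j k) (τ i A)
    Y = scale (∂-variable i k) (τ j A)
    Z = transposition j (transposition i k) ⊙ τ j (τ i A)

-- For constants, both sides test the same three inequalities v(i) < v(i+1), v(i) < v(i+2), v(i+1) <
-- v(i+2), in opposite orders. For x_k A, the middle one of the three terms with two letters
-- vanishes by nilpotency, and the outer two are exchanged.
τ-braid : ∀ i A → τ i (τ (suc i) (τ i A)) ≋ τ (suc i) (τ i (τ (suc i) A))
τ-braid i (const f f-cong) = const-cong λ v → begin
  raise i (raise j (raise i f)) v
    ≡⟨ cong (λ z → if ascends v i then z else 0ℤ) (trans
         (cong (λ b → if b then raise i f (v ∙ s i ∙ s j) else 0ℤ) (cong₂ (less v) (transposition-1+i i) ti2))
         (cong (λ z → if less v i (suc j) then z else 0ℤ)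
           (cong (λ b → if b then f (v ∙ s i ∙ s j ∙ s i) else 0ℤ)
             (cong₂ (less v) (trans (cong (transposition i) tji) (transposition-i i))
                             (trans (cong (transposition i) (transposition-i j)) ti2))))) ⟩
  (if less v i j then (if less v i (suc j) then (if less v j (suc j) then f (v ∙ s i ∙ s j ∙ s i) else 0ℤ) else 0ℤ) else 0ℤ)
    ≡⟨ cong (λ z → if less v i j then (if less v i (suc j) then (if less v j (suc j) then z else 0ℤ) else 0ℤ) else 0ℤ)
         (f-cong _ _ λ k → cong (to v) (transposition-braid i k)) ⟩
  (if less v i j then (if less v i (suc j) then (if less v j (suc j) then f (v ∙ s j ∙ s i ∙ s j) else 0ℤ) else 0ℤ) else 0ℤ)
    ≡⟨ if-reverse (less v i j) (less v i (suc j)) (less v j (suc j)) _ ⟩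
  (if less v j (suc j) then (if less v i (suc j) then (if less v i j then f (v ∙ s j ∙ s i ∙ s j) else 0ℤ) else 0ℤ) else 0ℤ)
    ≡⟨ cong (λ z → if ascends v j then z else 0ℤ) (trans
         (cong (λ b → if b then raise j f (v ∙ s j ∙ s i) else 0ℤ) (cong₂ (less v) tji (transposition-i j)))
         (cong (λ z → if less v i (suc j) then z else 0ℤ)
           (cong (λ b → if b then f (v ∙ s j ∙ s i ∙ s j) else 0ℤ)
             (cong₂ (less v) (trans (cong (transposition j) (transposition-1+i i)) tji)
                             (trans (cong (transposition j) ti2) (transposition-1+i j)))))) ⟨
  raise j (raise i (raise j f)) v ∎
  where
  open ≡-Reasoning
  j = suc i
  less : S∞ → ℕ → ℕ → Bool
  less v a b = does (to v a ℕ.<? to v b)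
  tji : transposition j i ≡ i
  tji = transposition-1+i-i i
  ti2 : transposition i (suc j) ≡ suc j
  ti2 = transposition-fixes i (suc j) ℕ.≤-refl
  if-reverse : ∀ a b c (z : ℤ) →
    (if a then (if b then (if c then z else 0ℤ) else 0ℤ) else 0ℤ) ≡
    (if c then (if b then (if a then z else 0ℤ) else 0ℤ) else 0ℤ)
  if-reverse true  b     true  z = refl
  if-reverse true  true  false z = refl
  if-reverse true  false false z = refl
  if-reverse false true  true  z = refl
  if-reverse false false true  z = refl
  if-reverse false b     false z = refl
τ-braid i (A ⊕ B) = ⊕-cong (τ-braid i A) (τ-braid i B)
τ-braid i (k ⊙ A)
  = ≋-trans (τττ-⊙ i j i k A)
    (≋-trans (⊕-cong ≋-refl (⊕-cong (scale-cong _ (τ-nilpotent i A)) (⊕-cong ≋-refl (⊙-cong _ (τ-braid i A)))))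
      (≋-trans (mk≋ exchange)
        (≋-sym (≋-trans (τττ-⊙ j i j k A) (⊕-cong ≋-refl (⊕-cong (scale-cong _ (τ-nilpotent j A)) ≋-refl))))))
  where
  j = suc i
  t : ℕ → ℕ → ℕ
  t = transposition
  lemma : ∀ a b c → a + (0ℤ + (b + c)) ≡ b + (0ℤ + (a + c))
  lemma = solve-∀
  exchange : ∀ v →
    ⟦ scale (∂-variable i k) (τ i (τ j A)) ⊕ scale (∂-variable j (t i k)) 𝟘 ⊕
      scale (∂-variable i (t j (t i k))) (τ j (τ i A)) ⊕ t i (t j (t i k)) ⊙ τ j (τ i (τ j A)) ⟧ v ≈ₚ
    ⟦ scale (∂-variable j k) (τ j (τ i A)) ⊕ scale (∂-variable i (t j k)) 𝟘 ⊕
      scale (∂-variable j (t i (t j k))) (τ i (τ j A)) ⊕ t j (t i (t j k)) ⊙ τ j (τ i (τ j A)) ⟧ v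
  exchange v m
    rewrite ∂-variable-braid i k | ∂-variable-braid′ i k | transposition-braid i k
    = trans (expand X Y (∂-variable j (t i k)))
      (trans (lemma (coeff m (⟦ X ⟧ v)) (coeff m (⟦ Y ⟧ v)) (coeff m (⟦ Z ⟧ v)))
        (sym (expand Y X (∂-variable i (t j k)))))
    where
    X = scale (∂-variable i k) (τ i (τ j A))
    Y = scale (∂-variable j k) (τ j (τ i A))
    Z = t j (t i (t j k)) ⊙ τ j (τ i (τ j A))
    expand : ∀ X Y z → coeff m (⟦ X ⊕ scale z 𝟘 ⊕ Y ⊕ Z ⟧ v) ≡
      coeff m (⟦ X ⟧ v) + (0ℤ + (coeff m (⟦ Y ⟧ v) + coeff m (⟦ Z ⟧ v)))
    expand X Y z = trans (coeff-⊕ X (scale z 𝟘 ⊕ Y ⊕ Z) v m) (cong (coeff m (⟦ X ⟧ v) +_)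
      (trans (coeff-⊕ (scale z 𝟘) (Y ⊕ Z) v m) (cong₂ _+_
        (trans (coeff-scale z 𝟘 v m) (trans (cong (z *_) (coeff-mono-0 m)) (ℤ.*-zeroʳ z)))
        (coeff-⊕ Y Z v m))))

-- Reduced words

length-≤ : ∀ {A : Set} {xs ys : List A} → Unique xs → (∀ {a} → a ∈ xs → a ∈ ys) → length xs ≤ length ys
length-≤ {xs = []}     _           _ = z≤n
length-≤ {xs = a ∷ xs} (a∉xs ∷ !xs) sub with ∈-∃++ (sub (here refl))
... | bs , cs , refl = subst (suc (length xs) ≤_) (sym (↭-length (shift a bs cs)))
  (s≤s (length-≤ !xs λ b∈xs → remove (All.lookup a∉xs b∈xs) (∈-resp-↭ (shift a bs cs) (sub (there b∈xs)))))
  where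
  remove : ∀ {b} → a ≢ b → b ∈ a ∷ bs ++ cs → b ∈ bs ++ cs
  remove a≢b (here e)  = contradiction (sym e) a≢b
  remove a≢b (there p) = p

transposition-mono : ∀ i {a b} → a < b → transposition i a < transposition i b ⊎ (a ≡ i × b ≡ suc i)
transposition-mono zero    {zero}        {suc zero}    _       = inj₂ (refl , refl)
transposition-mono zero    {zero}        {suc (suc b)} _       = inj₁ (s≤s (s≤s z≤n))
transposition-mono zero    {suc zero}    {suc (suc b)} _       = inj₁ (s≤s z≤n)
transposition-mono zero    {suc (suc a)} {suc (suc b)} a<b     = inj₁ a<b
transposition-mono zero    {suc a}       {suc zero}    (s≤s ())
transposition-mono (suc i) {zero}        {suc b}       _       = inj₁ (s≤s z≤n)
transposition-mono (suc i) {suc a}       {suc b}       (s≤s a<b) with transposition-mono i a<b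
... | inj₁ p             = inj₁ (s≤s p)
... | inj₂ (refl , refl) = inj₂ (refl , refl)

-- Relabelling by s_i injects the inversions of w into those of w′: only the pair (i, i+1) has its
-- order reversed, and at an ascent it is not an inversion.
ℓ-ascent : ∀ {w w′} i → w′ ≈ w ∙ s i → to w i < to w (suc i) → ℓ w ≤ ℓ w′
ℓ-ascent {w} {w′} i w′≈wsᵢ asc = subst (_≤ ℓ w′) (length-map f (inversions w))
  (length-≤ (Unique.map⁺ f-injective (Unique.filter⁺ (isInversion? w) (Unique.cartesianProduct⁺ (Unique.upTo⁺ (bound w)) (Unique.upTo⁺ (bound w))))) image)
  where
  t = transposition i
  f : ℕ × ℕ → ℕ × ℕ
  f (a , b) = t a , t b
  f-injective : ∀ {p q} → f p ≡ f q → p ≡ q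
  f-injective e = cong₂ _,_ (to-injective (s i) (cong proj₁ e)) (to-injective (s i) (cong proj₂ e))
  w′t : ∀ a → to w′ (t a) ≡ to w a
  w′t a = trans (w′≈wsᵢ (t a)) (cong (to w) (transposition-involutive i a))
  image : ∀ {q} → q ∈ map f (inversions w) → q ∈ inversions w′
  image q∈ with ∈-map⁻ f q∈
  ... | (a , b) , p∈ , refl with ∈-filter⁻ (isInversion? w) {xs = cartesianProduct (upTo (bound w)) (upTo (bound w))} p∈
  ...   | _ , a<b , wb<wa with transposition-mono i a<b
  ...     | inj₁ ta<tb         = ∈-inversions w′ (ta<tb , subst₂ _<_ (sym (w′t b)) (sym (w′t a)) wb<wa)
  ...     | inj₂ (refl , refl) = contradiction wb<wa (ℕ.<-asym asc)

Descent : S∞ → ℕ → Set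
Descent w i = to w (suc i) < to w i

¬descent⇒ascent : ∀ w i → ¬ Descent w i → to w i < to w (suc i)
¬descent⇒ascent w i ¬d = ℕ.≤∧≢⇒< (ℕ.≮⇒≥ ¬d) (ℕ.m≢1+n+m i {0} ∘ to-injective w)

-- Together with the next lemma this turns the length conditions of the recurrence into comparisons
-- of two values.
ℓ-descent : ∀ w i → ℓ (w ∙ s i) < ℓ w → Descent w i
ℓ-descent w i ℓ< with to w (suc i) ℕ.<? to w i
... | yes d = d
... | no ¬d = contradiction (ℓ-ascent {w} {w ∙ s i} i (λ _ → refl) (¬descent⇒ascent w i ¬d)) (ℕ.<⇒≱ ℓ<)

¬ℓ-descent : ∀ w i → ℓ w < ℓ (w ∙ s i) → ¬ Descent w i
¬ℓ-descent w i ℓ< d = ℕ.<⇒≱ ℓ< (ℓ-ascent {w ∙ s i} {w} i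
  (λ j → cong (to w) (sym (transposition-involutive i j)))
  (subst₂ _<_ (cong (to w) (sym (transposition-i i))) (cong (to w) (sym (transposition-1+i i))) d))

-- Letters are split off on the right, as in the recurrence, and the descent at each letter replaces
-- any mention of length.
data Reduced (w : S∞) : List ℕ → Set where
  done : w ≈ 𝟙 → Reduced w []
  step : ∀ i {a} → Descent w i → Reduced (w ∙ s i) a → Reduced w (a ∷ʳ i)

reduced-resp-≈ : ∀ {w w′ a} → w ≈ w′ → Reduced w a → Reduced w′ a
reduced-resp-≈ w≈w′ (done w≈𝟙)   = done λ j → trans (sym (w≈w′ j)) (w≈𝟙 j)
reduced-resp-≈ w≈w′ (step i d r) = step i (subst₂ _<_ (w≈w′ (suc i)) (w≈w′ i) d)
  (reduced-resp-≈ (λ j → w≈w′ (transposition i j)) r)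

derivation⇒reduced : ∀ {u w D} → IsSkewDividedDifference u w D → ∃ (Reduced w)
derivation⇒reduced {w = w} (identity w≈𝟙 _)      = [] , done w≈𝟙
derivation⇒reduced {w = w} (vanish w≈𝟙 _)        = [] , done w≈𝟙
derivation⇒reduced {w = w} (descent i ℓ< _ δ _)  with derivation⇒reduced δ
... | a , r = a ∷ʳ i , step i (ℓ-descent w i ℓ<) r
derivation⇒reduced {w = w} (ascent i ℓ< _ δ)     with derivation⇒reduced δ
... | a , r = a ∷ʳ i , step i (ℓ-descent w i ℓ<) r

reducedWord : ∀ w → ∃ (Reduced w)
-- Any lower index would serve: only the descents of w chosen in the derivation are read.
reducedWord w = derivation⇒reduced (proj₂ (skewDividedDifference w w))

act : List ℕ → Element → Element
act a A = foldr τ A a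

act-∷ʳ : ∀ a i A → act (a ∷ʳ i) A ≡ act a (τ i A)
act-∷ʳ a i A = foldr-∷ʳ τ A i a

act-cong : ∀ a {A B} → A ≋ B → act a A ≋ act a B
act-cong []      p = p
act-cong (i ∷ a) p = τ-cong i (act-cong a p)

act-⊕ : ∀ a A B → act a (A ⊕ B) ≡ act a A ⊕ act a B
act-⊕ []      A B = refl
act-⊕ (i ∷ a) A B = cong (τ i) (act-⊕ a A B)

length-∷ʳ : ∀ (a : List ℕ) i → length (a ∷ʳ i) ≡ suc (length a)
length-∷ʳ a i = trans (length-++ a) (ℕ.+-comm (length a) 1)

-- The local step of Matsumoto's argument: two reduced words of w, one ending in i and one in j,
-- with the same action. The last letters are kept apart because the induction hypothesis is applied
-- to w s_i and w s_j.
record Diamond (w : S∞) (i j : ℕ) : Set where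
  field
    {left right} : List ℕ
    left-reduced  : Reduced (w ∙ s i) left
    right-reduced : Reduced (w ∙ s j) right
    same-length   : length left ≡ length right
    same-action   : ∀ A → act left (τ i A) ≋ act right (τ j A)

diamond-sym : ∀ {w i j} → Diamond w i j → Diamond w j i
diamond-sym D = record
  { left-reduced  = right-reduced
  ; right-reduced = left-reduced
  ; same-length   = sym same-length
  ; same-action   = λ A → ≋-sym (same-action A)
  }
  where open Diamond D

descent-≡ : ∀ w {a b c d} → a ≡ c → b ≡ d → to w c < to w d → to w a < to w b
descent-≡ w refl refl p = p

diamond-far : ∀ w {i j} → suc i < j → Descent w i → Descent w j → Diamond w i j
diamond-far w {i} {j} i<j dᵢ dⱼ with reducedWord (w ∙ s i ∙ s j)
... | c , r = record
  { left-reduced  = step j (descent-≡ w (transposition-fixes i (suc j) (ℕ.m≤n⇒m≤1+n i<j)) (transposition-fixes i j i<j) dⱼ) r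
  ; right-reduced = step i (descent-≡ w (transposition-other (ℕ.<⇒≢ i<j) (ℕ.<⇒≢ (ℕ.m≤n⇒m≤1+n i<j)))
      (transposition-other (ℕ.<⇒≢ i<j′) (ℕ.<⇒≢ (ℕ.m≤n⇒m≤1+n i<j′))) dᵢ)
      (reduced-resp-≈ (λ k → cong (to w) (transposition-far i j k i<j)) r)
  ; same-length   = trans (length-∷ʳ c j) (sym (length-∷ʳ c i))
  ; same-action   = λ A → ≋-trans (≋-reflexive (act-∷ʳ c j (τ i A)))
      (≋-trans (act-cong c (≋-sym (τ-far i<j A))) (≋-reflexive (sym (act-∷ʳ c i (τ j A)))))
  }
  where
  i<j′ : i < j
  i<j′ = ℕ.<-trans (ℕ.n<1+n i) i<j

-- Here w(i) > w(i+1) > w(i+2), so w ends both in s_i s_{i+1} s_i and in s_{i+1} s_i s_{i+1} after a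
-- common reduced word `c`.
diamond-braid : ∀ w i → Descent w i → Descent w (suc i) → Diamond w i (suc i)
diamond-braid w i dᵢ dⱼ with reducedWord (w ∙ s i ∙ s (suc i) ∙ s i)
... | c , r = record
  { left-reduced  = step j (descent-≡ w ti2 (transposition-1+i i) (ℕ.<-trans dⱼ dᵢ))
      (step i (descent-≡ w (trans (cong (transposition i) (transposition-i j)) ti2)
                           (trans (cong (transposition i) tji) (transposition-i i)) dⱼ) r)
  ; right-reduced = step i (descent-≡ w (transposition-i j) tji (ℕ.<-trans dⱼ dᵢ))
      (step j (descent-≡ w (trans (cong (transposition j) ti2) (transposition-1+i j))
                           (trans (cong (transposition j) (transposition-1+i i)) tji) dᵢ)
        (reduced-resp-≈ (λ k → cong (to w) (transposition-braid i k)) r))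
  ; same-length   = trans (length-∷ʳ² i j) (sym (length-∷ʳ² j i))
  ; same-action   = λ A → ≋-trans (≋-reflexive (act-∷ʳ² i j (τ i A)))
      (≋-trans (act-cong c (τ-braid i A)) (≋-reflexive (sym (act-∷ʳ² j i (τ j A)))))
  }
  where
  j = suc i
  tji : transposition j i ≡ i
  tji = transposition-1+i-i i
  ti2 : transposition i (suc j) ≡ suc j
  ti2 = transposition-fixes i (suc j) ℕ.≤-refl
  length-∷ʳ² : ∀ h k → length (c ∷ʳ h ∷ʳ k) ≡ suc (suc (length c))
  length-∷ʳ² h k = trans (length-∷ʳ (c ∷ʳ h) k) (cong suc (length-∷ʳ c h))
  act-∷ʳ² : ∀ h k A → act (c ∷ʳ h ∷ʳ k) A ≡ act c (τ h (τ k A))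
  act-∷ʳ² h k A = trans (act-∷ʳ (c ∷ʳ h) k A) (act-∷ʳ c h (τ k A))

diamond : ∀ w {i j} → i < j → Descent w i → Descent w j → Diamond w i j
diamond w {i} {j} i<j dᵢ dⱼ with ℕ.m≤n⇒m<n∨m≡n i<j
... | inj₁ 1+i<j = diamond-far w 1+i<j dᵢ dⱼ
... | inj₂ refl  = diamond-braid w i dᵢ dⱼ

𝟙-no-descent : ∀ {w i} → w ≈ 𝟙 → ¬ Descent w i
𝟙-no-descent {w} {i} w≈𝟙 d = ℕ.<-asym (subst₂ _<_ (w≈𝟙 (suc i)) (w≈𝟙 i) d) (ℕ.n<1+n i)

-- Induction on the length bound `n`. For different last letters, the first word is compared with
-- one side of a diamond and the other side with the second word. Equality of lengths is proved
-- along the way, since it puts the second comparison within the bound. Permutations are equal only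
-- pointwise, hence w and w′.
matsumoto : ∀ n {w w′ a b} → length a ≤ n → w ≈ w′ → Reduced w a → Reduced w′ b →
  length a ≡ length b × (∀ A → act a A ≋ act b A)
matsumoto n _ w≈w′ (done _)    (done _)      = refl , λ A → ≋-refl
matsumoto n {w} {w′} _ w≈w′ (done w≈𝟙) (step i d _) = contradiction d (𝟙-no-descent {w′} λ j → trans (sym (w≈w′ j)) (w≈𝟙 j))
matsumoto n {w} {w′} _ w≈w′ (step i d _) (done w′≈𝟙) = contradiction d (𝟙-no-descent {w} λ j → trans (w≈w′ j) (w′≈𝟙 j))
matsumoto zero a≤n _ (step i {a} _ _) (step _ _ _) = contradiction (subst (_≤ 0) (length-∷ʳ a i) a≤n) λ ()
matsumoto (suc n) {w} {w′} ai≤n w≈w′ (step i {a} dᵢ r) (step j {b} dⱼ r′) = compare (ℕ.<-cmp i j)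
  where
  a≤n : length a ≤ n
  a≤n = ℕ.≤-pred (subst (_≤ suc n) (length-∷ʳ a i) ai≤n)
  conclude : length a ≡ length b → (∀ A → act a (τ i A) ≋ act b (τ j A)) →
    length (a ∷ʳ i) ≡ length (b ∷ʳ j) × (∀ A → act (a ∷ʳ i) A ≋ act (b ∷ʳ j) A)
  conclude e p = trans (length-∷ʳ a i) (trans (cong suc e) (sym (length-∷ʳ b j))) ,
    λ A → ≋-trans (≋-reflexive (act-∷ʳ a i A)) (≋-trans (p A) (≋-reflexive (sym (act-∷ʳ b j A))))
  join : Diamond w i j → length (a ∷ʳ i) ≡ length (b ∷ʳ j) × (∀ A → act (a ∷ʳ i) A ≋ act (b ∷ʳ j) A)
  join D with matsumoto n a≤n (λ _ → refl) r (Diamond.left-reduced D)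
  ... | e , p with matsumoto n (ℕ.≤-trans (ℕ.≤-reflexive (sym (trans e (Diamond.same-length D)))) a≤n)
                   (λ k → w≈w′ (transposition j k)) (Diamond.right-reduced D) r′
  ...   | e′ , p′ = conclude (trans e (trans (Diamond.same-length D) e′))
    λ A → ≋-trans (p (τ i A)) (≋-trans (Diamond.same-action D A) (p′ (τ j A)))
  d′ : Descent w j
  d′ = subst₂ _<_ (sym (w≈w′ (suc j))) (sym (w≈w′ j)) dⱼ
  compare : Tri (i < j) (i ≡ j) (j < i) →
    length (a ∷ʳ i) ≡ length (b ∷ʳ j) × (∀ A → act (a ∷ʳ i) A ≋ act (b ∷ʳ j) A)
  compare (tri< i<j _ _) = join (diamond w i<j dᵢ d′)
  compare (tri> _ _ j<i) = join (diamond-sym (diamond w j<i d′ dᵢ))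
  compare (tri≈ _ refl _) with matsumoto n a≤n (λ k → w≈w′ (transposition i k)) r r′
  ... | e , p = conclude e (λ A → p (τ i A))

reduced-words-agree : ∀ {w a b} → Reduced w a → Reduced w b → ∀ A → act a A ≋ act b A
reduced-words-agree {a = a} r r′ = proj₂ (matsumoto (length a) ℕ.≤-refl (λ _ → refl) r r′)

-- Skew divided differences as values of the action

infix 4 _≈?_
_≈?_ : ∀ u v → Dec (u ≈ v)
u ≈? v = map′ extend (λ u≈v {i} _ → u≈v i) (ℕ.allUpTo? (λ i → to u i ℕ.≟ to v i) (bound u ⊔ bound v))
  where
  extend : (∀ {i} → i < bound u ⊔ bound v → to u i ≡ to v i) → u ≈ v
  extend h i with ℕ.<-≤-connex i (bound u ⊔ bound v)
  ... | inj₁ i<N = h i<N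
  ... | inj₂ N≤i = trans (fixes u i (ℕ.m⊔n≤o⇒m≤o _ _ N≤i)) (sym (fixes v i (ℕ.m⊔n≤o⇒n≤o (bound u) _ N≤i)))

indicator : S∞ → S∞ → ℤ
indicator u v = if does (u ≈? v) then 1ℤ else 0ℤ

indicator-cong : ∀ u v w → v ≈ w → indicator u v ≡ indicator u w
indicator-cong u v w v≈w = if-cong (does-⇔ (mk⇔
  (λ u≈v i → trans (u≈v i) (v≈w i)) (λ u≈w i → trans (u≈w i) (sym (v≈w i)))) (u ≈? v) (u ≈? w))

infix 8 _⊗_
_⊗_ : Poly → S∞ → Element
[]            ⊗ u = 𝟘
((c , m) ∷ P) ⊗ u = foldr _⊙_ (const (λ v → indicator u v * c) (λ v w v≈w → cong (_* c) (indicator-cong u v w v≈w))) m ⊕ P ⊗ u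

⟦monomial⟧ : ∀ {f} f-cong m v → ⟦ foldr _⊙_ (const f f-cong) m ⟧ v ≡ mono (f v) m
⟦monomial⟧ f-cong []      v = refl
⟦monomial⟧ f-cong (k ∷ m) v = cong (k ◃_) (⟦monomial⟧ f-cong m v)

coeff-⊗ : ∀ P u v m → coeff m (⟦ P ⊗ u ⟧ v) ≡ indicator u v * coeff m P
coeff-⊗ []            u v m = trans (coeff-mono-0 m) (sym (ℤ.*-zeroʳ (indicator u v)))
coeff-⊗ ((c , a) ∷ P) u v m = begin
  coeff m (⟦ foldr _⊙_ (const _ _) a ⊕ P ⊗ u ⟧ v)
    ≡⟨ coeff-⊕ (foldr _⊙_ (const _ _) a) (P ⊗ u) v m ⟩
  coeff m (⟦ foldr _⊙_ (const _ _) a ⟧ v) + coeff m (⟦ P ⊗ u ⟧ v)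
    ≡⟨ cong₂ _+_ (trans (cong (coeff m) (⟦monomial⟧ _ a v))
         (trans (ℤ.+-identityʳ _) (if-* (does (m ↭? a)) (indicator u v) c))) (coeff-⊗ P u v m) ⟩
  indicator u v * (if does (m ↭? a) then c else 0ℤ) + indicator u v * coeff m P
    ≡⟨ ℤ.*-distribˡ-+ (indicator u v) _ _ ⟨
  indicator u v * coeff m ((c , a) ∷ P) ∎
  where open ≡-Reasoning

∂-· : ∀ i z P → ∂ i (z · P) ≈ₚ z · ∂ i P
∂-· i z []            m = refl
∂-· i z ((c , a) ∷ P) m = begin
  coeff m ((z * c) · ∂a ++ ∂ i (z · P))           ≡⟨ coeff-++ m ((z * c) · ∂a) _ ⟩
  coeff m ((z * c) · ∂a) + coeff m (∂ i (z · P))  ≡⟨ cong₂ _+_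
    (trans (coeff-· (z * c) ∂a m) (trans (ℤ.*-assoc z c _) (cong (z *_) (sym (coeff-· c ∂a m)))))
    (trans (∂-· i z P m) (coeff-· z (∂ i P) m)) ⟩
  z * coeff m (c · ∂a) + z * coeff m (∂ i P)      ≡⟨ ℤ.*-distribˡ-+ z _ _ ⟨
  z * (coeff m (c · ∂a) + coeff m (∂ i P))        ≡⟨ cong (z *_) (coeff-++ m (c · ∂a) _) ⟨
  z * coeff m (c · ∂a ++ ∂ i P)                   ≡⟨ coeff-· z (c · ∂a ++ ∂ i P) m ⟨
  coeff m (z · (c · ∂a ++ ∂ i P))                 ∎
  where
  open ≡-Reasoning
  ∂a = ∂-monomial i a

coeff-τ-⊗ : ∀ i P u v m → coeff m (⟦ τ i (P ⊗ u) ⟧ v) ≡ indicator u v * coeff m (∂ i P) +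
  (if ascends v i then indicator u (v ∙ s i) * coeff m (s i ▷ P) else 0ℤ)
coeff-τ-⊗ i P u v m = trans (⟦τ⟧ i (P ⊗ u) v m) (trans (coeff-++ m (∂ i (⟦ P ⊗ u ⟧ v)) _)
  (cong₂ _+_ ∂-part moved-part))
  where
  ∂-part : coeff m (∂ i (⟦ P ⊗ u ⟧ v)) ≡ indicator u v * coeff m (∂ i P)
  ∂-part = trans (∂-cong i {⟦ P ⊗ u ⟧ v} {indicator u v · P} (λ n → trans (coeff-⊗ P u v n) (sym (coeff-· (indicator u v) P n))) m)
    (trans (∂-· i (indicator u v) P m) (coeff-· (indicator u v) (∂ i P) m))
  moved-part : coeff m (moved i (P ⊗ u) v) ≡ (if ascends v i then indicator u (v ∙ s i) * coeff m (s i ▷ P) else 0ℤ)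
  moved-part with ascends v i
  ... | true  = trans (coeff-▷ (s i) (⟦ P ⊗ u ⟧ (v ∙ s i)) m)
    (trans (coeff-⊗ P u (v ∙ s i) _) (cong (indicator u (v ∙ s i) *_) (sym (coeff-▷ (s i) P m))))
  ... | false = refl

indicator-∙s : ∀ u v i → indicator u (v ∙ s i) ≡ indicator (u ∙ s i) v
indicator-∙s u v i = if-cong (does-⇔ (mk⇔
  (λ u≈vs j → trans (u≈vs (transposition i j)) (cong (to v) (transposition-involutive i j)))
  (λ us≈v j → trans (cong (to u) (sym (transposition-involutive i j))) (us≈v (transposition i j))))
  (u ≈? v ∙ s i) (u ∙ s i ≈? v))

indicator-≉ : ∀ {u v} → ¬ (u ≈ v) → indicator u v ≡ 0ℤ
indicator-≉ {u} {v} u≉v = if-cong (dec-false (u ≈? v) u≉v)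

-- v < v s_i for v = u s_i exactly if i is a descent of u.
τ-⊗-descent : ∀ i P u → Descent u i → τ i (P ⊗ u) ≋ ∂ i P ⊗ u ⊕ (s i ▷ P) ⊗ (u ∙ s i)
τ-⊗-descent i P u d = mk≋ λ v m → trans (coeff-τ-⊗ i P u v m) (trans
  (cong₂ _+_ (sym (coeff-⊗ (∂ i P) u v m)) (trans (part v _) (sym (coeff-⊗ (s i ▷ P) (u ∙ s i) v m))))
  (sym (coeff-⊕ (∂ i P ⊗ u) ((s i ▷ P) ⊗ (u ∙ s i)) v m)))
  where
  part : ∀ v z → (if ascends v i then indicator u (v ∙ s i) * z else 0ℤ) ≡ indicator (u ∙ s i) v * z
  part v z with to v i ℕ.<? to v (suc i)
  ... | yes p = trans (if-cong (dec-true (to v i ℕ.<? to v (suc i)) p)) (cong (_* z) (indicator-∙s u v i))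
  ... | no ¬p = trans (if-cong (dec-false (to v i ℕ.<? to v (suc i)) ¬p)) (cong (_* z) (sym (indicator-≉ {u ∙ s i} {v} λ us≈v →
    ¬p (subst₂ _<_ (trans (cong (to u) (sym (transposition-i i))) (us≈v i))
                   (trans (cong (to u) (sym (transposition-1+i i))) (us≈v (suc i))) d))))

τ-⊗-ascent : ∀ i P u → ¬ Descent u i → τ i (P ⊗ u) ≋ ∂ i P ⊗ u
τ-⊗-ascent i P u ¬d = mk≋ λ v m → trans (coeff-τ-⊗ i P u v m) (trans
  (cong₂ _+_ (sym (coeff-⊗ (∂ i P) u v m)) (part v _)) (ℤ.+-identityʳ _))
  where
  part : ∀ v z → (if ascends v i then indicator u (v ∙ s i) * z else 0ℤ) ≡ 0ℤ
  part v z with to v i ℕ.<? to v (suc i)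
  ... | yes p = trans (if-cong (dec-true (to v i ℕ.<? to v (suc i)) p)) (cong (_* z) (indicator-≉ {u} {v ∙ s i} λ u≈vs →
    ¬d (subst₂ _<_ (sym (trans (u≈vs (suc i)) (cong (to v) (transposition-1+i i))))
                   (sym (trans (u≈vs i) (cong (to v) (transposition-i i)))) p)))
  ... | no ¬p = if-cong (dec-false (to v i ℕ.<? to v (suc i)) ¬p)

-- The last letter of the word acts first, on `P ⊗ u`, and yields the terms of the recurrence. The
-- word `a` is arbitrary because the two premises of `descent` may follow different descents of w
-- s_i and must be evaluated on one common word.
skew-as-action : ∀ {u w D a} → IsSkewDividedDifference u w D → Reduced w a →
  ∀ P → D P ≈ₚ ⟦ act a (P ⊗ u) ⟧ 𝟙
skew-as-action {u} (identity w≈𝟙 u≈𝟙) r P m = sym (trans (at (reduced-words-agree r (done w≈𝟙) (P ⊗ u)) 𝟙 m)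
  (trans (coeff-⊗ P u 𝟙 m) (trans (cong (_* coeff m P) (if-cong (dec-true (u ≈? 𝟙) u≈𝟙))) (ℤ.*-identityˡ _))))
skew-as-action {u} (vanish w≈𝟙 u≉𝟙) r P m = sym (trans (at (reduced-words-agree r (done w≈𝟙) (P ⊗ u)) 𝟙 m)
  (trans (coeff-⊗ P u 𝟙 m) (cong (_* coeff m P) (indicator-≉ {u} {𝟙} u≉𝟙))))
skew-as-action {u} {w} {a = a} (descent i {D} {D′} w> u> δ δ′) r P m with derivation⇒reduced δ
... | b , r′ = begin
  coeff m (D (∂ i P) +ₚ D′ (s i ▷ P))
    ≡⟨ coeff-++ m (D (∂ i P)) _ ⟩
  coeff m (D (∂ i P)) + coeff m (D′ (s i ▷ P))
    ≡⟨ cong₂ _+_ (skew-as-action δ r′ (∂ i P) m) (skew-as-action δ′ r′ (s i ▷ P) m) ⟩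
  coeff m (⟦ act b (∂ i P ⊗ u) ⟧ 𝟙) + coeff m (⟦ act b ((s i ▷ P) ⊗ (u ∙ s i)) ⟧ 𝟙)
    ≡⟨ coeff-⊕ (act b (∂ i P ⊗ u)) (act b ((s i ▷ P) ⊗ (u ∙ s i))) 𝟙 m ⟨
  coeff m (⟦ act b (∂ i P ⊗ u) ⊕ act b ((s i ▷ P) ⊗ (u ∙ s i)) ⟧ 𝟙)
    ≡⟨ cong (λ A → coeff m (⟦ A ⟧ 𝟙)) (act-⊕ b (∂ i P ⊗ u) ((s i ▷ P) ⊗ (u ∙ s i))) ⟨
  coeff m (⟦ act b (∂ i P ⊗ u ⊕ (s i ▷ P) ⊗ (u ∙ s i)) ⟧ 𝟙)
    ≡⟨ at (act-cong b (τ-⊗-descent i P u (ℓ-descent u i u>))) 𝟙 m ⟨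
  coeff m (⟦ act b (τ i (P ⊗ u)) ⟧ 𝟙)
    ≡⟨ cong (λ A → coeff m (⟦ A ⟧ 𝟙)) (act-∷ʳ b i (P ⊗ u)) ⟨
  coeff m (⟦ act (b ∷ʳ i) (P ⊗ u) ⟧ 𝟙)
    ≡⟨ at (reduced-words-agree r (step i (ℓ-descent w i w>) r′) (P ⊗ u)) 𝟙 m ⟨
  coeff m (⟦ act a (P ⊗ u) ⟧ 𝟙) ∎
  where open ≡-Reasoning
skew-as-action {u} {w} {a = a} (ascent i {D} w> u< δ) r P m with derivation⇒reduced δ
... | b , r′ = begin
  coeff m (D (∂ i P))
    ≡⟨ skew-as-action δ r′ (∂ i P) m ⟩
  coeff m (⟦ act b (∂ i P ⊗ u) ⟧ 𝟙)
    ≡⟨ at (act-cong b (τ-⊗-ascent i P u (¬ℓ-descent u i u<))) 𝟙 m ⟨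
  coeff m (⟦ act b (τ i (P ⊗ u)) ⟧ 𝟙)
    ≡⟨ cong (λ A → coeff m (⟦ A ⟧ 𝟙)) (act-∷ʳ b i (P ⊗ u)) ⟨
  coeff m (⟦ act (b ∷ʳ i) (P ⊗ u) ⟧ 𝟙)
    ≡⟨ at (reduced-words-agree r (step i (ℓ-descent w i w>) r′) (P ⊗ u)) 𝟙 m ⟨
  coeff m (⟦ act a (P ⊗ u) ⟧ 𝟙) ∎
  where open ≡-Reasoning

-- Grassmannian normal forms

τ-⊙-same : ∀ i A → τ i (i ⊙ A) ≋ A ⊕ suc i ⊙ τ i A
τ-⊙-same i A rewrite ∂-variable-i i | transposition-i i = ⊕-cong (scale-1 A) ≋-refl

τ-⊙-other : ∀ {i k} A → k ≢ i → k ≢ suc i → τ i (k ⊙ A) ≋ k ⊙ τ i A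
τ-⊙-other {i} {k} A k≢i k≢1+i rewrite ∂-variable-other k≢i k≢1+i | transposition-other k≢i k≢1+i =
  ≋-trans (⊕-cong (scale-0 A) ≋-refl) (⊕-identityˡ (k ⊙ τ i A))

-- x_i x_{i+1} is symmetric: the 1 produced by x_i cancels the -1 produced by x_{i+1}.
τ-⊙-pair : ∀ i A → τ i (i ⊙ suc i ⊙ A) ≋ i ⊙ suc i ⊙ τ i A
τ-⊙-pair i A = ≋-trans (τ-⊙-same i (suc i ⊙ A)) (≋-trans (mk≋ cancels) (⊙-comm (suc i) i (τ i A)))
  where
  B = suc i ⊙ A
  lemma : ∀ y z → y + (-1ℤ * y + z) ≡ z
  lemma = solve-∀
  cancels : ∀ v → ⟦ B ⊕ suc i ⊙ τ i B ⟧ v ≈ₚ ⟦ suc i ⊙ i ⊙ τ i A ⟧ v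
  cancels v m rewrite ∂-variable-1+i i | transposition-1+i i = begin
    coeff m (⟦ B ⊕ suc i ⊙ (scale -1ℤ A ⊕ i ⊙ τ i A) ⟧ v)
      ≡⟨ coeff-⊕ B (suc i ⊙ (scale -1ℤ A ⊕ i ⊙ τ i A)) v m ⟩
    coeff m (⟦ B ⟧ v) + coeff m (suc i ◃ (⟦ scale -1ℤ A ⟧ v ++ ⟦ i ⊙ τ i A ⟧ v))
      ≡⟨ cong (λ P → coeff m (⟦ B ⟧ v) + coeff m P) (map-++ _ (⟦ scale -1ℤ A ⟧ v) (⟦ i ⊙ τ i A ⟧ v)) ⟩
    coeff m (⟦ B ⟧ v) + coeff m (⟦ scale -1ℤ B ⊕ suc i ⊙ i ⊙ τ i A ⟧ v)
      ≡⟨ cong (coeff m (⟦ B ⟧ v) +_) (trans (coeff-⊕ (scale -1ℤ B) (suc i ⊙ i ⊙ τ i A) v m)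
           (cong (_+ coeff m (⟦ suc i ⊙ i ⊙ τ i A ⟧ v)) (coeff-scale -1ℤ B v m))) ⟩
    coeff m (⟦ B ⟧ v) + (-1ℤ * coeff m (⟦ B ⟧ v) + coeff m (⟦ suc i ⊙ i ⊙ τ i A ⟧ v))
      ≡⟨ lemma (coeff m (⟦ B ⟧ v)) _ ⟩
    coeff m (⟦ suc i ⊙ i ⊙ τ i A ⟧ v) ∎
    where open ≡-Reasoning

-- The cycle s_{p+d-1} ⋯ s_p, which takes p to p + d; thus m_p = p + d.
row : ℕ → ℕ → Element → Element
row p zero    A = A
row p (suc d) A = τ (p ℕ.+ d) (row p d A)

row-cong : ∀ p d {A B} → A ≋ B → row p d A ≋ row p d B
row-cong p zero    e = e
row-cong p (suc d) e = τ-cong (p ℕ.+ d) (row-cong p d e)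

row-𝟘 : ∀ p d → row p d 𝟘 ≋ 𝟘
row-𝟘 p zero    = ≋-refl
row-𝟘 p (suc d) = ≋-trans (τ-cong (p ℕ.+ d) (row-𝟘 p d)) (τ-𝟘 (p ℕ.+ d))

row-⊕ : ∀ p d A B → row p d (A ⊕ B) ≡ row p d A ⊕ row p d B
row-⊕ p zero    A B = refl
row-⊕ p (suc d) A B = cong (τ (p ℕ.+ d)) (row-⊕ p d A B)

row-first : ∀ p d A → row p (suc d) A ≡ row (suc p) d (τ p A)
row-first p zero    A = cong (λ q → τ q A) (ℕ.+-identityʳ p)
row-first p (suc d) A = cong₂ τ (ℕ.+-suc p d) (row-first p d A)

row-above : ∀ p d {i} A → p ℕ.+ d < i → τ i (row p d A) ≋ row p d (τ i A)
row-above p zero    A _ = ≋-refl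
row-above p (suc d) {i} A q = ≋-trans (≋-sym (τ-far (subst (_< i) (ℕ.+-suc p d) q) (row p d A)))
  (τ-cong (p ℕ.+ d) (row-above p d A (ℕ.<-trans (ℕ.+-monoʳ-< p (ℕ.n<1+n d)) q)))

row-below : ∀ p d {i} A → suc i < p → τ i (row p d A) ≋ row p d (τ i A)
row-below p zero    A _ = ≋-refl
row-below p (suc d) A q = ≋-trans (τ-far (ℕ.<-≤-trans q (ℕ.m≤m+n p d)) (row p d A))
  (τ-cong (p ℕ.+ d) (row-below p d A q))

row-⊙ : ∀ p d {k} A → k < p → row p d (k ⊙ A) ≋ k ⊙ row p d A
row-⊙ p zero    A _ = ≋-refl
row-⊙ p (suc d) {k} A k<p = ≋-trans (τ-cong (p ℕ.+ d) (row-⊙ p d A k<p))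
  (τ-⊙-other (row p d A) (ℕ.<⇒≢ k<p+d) (ℕ.<⇒≢ (ℕ.m≤n⇒m≤1+n k<p+d)))
  where
  k<p+d : k < p ℕ.+ d
  k<p+d = ℕ.<-≤-trans k<p (ℕ.m≤m+n p d)

data Last (p i : ℕ) : ℕ → Set where
  last : ∀ d → i ≡ p ℕ.+ d → Last p i (suc d)

last? : ∀ {p i} d → p ≤ i → suc i ≡ p ℕ.+ d → Last p i d
last? {p} {i} zero    p≤i e = contradiction (subst (_≤ i) (trans (sym (ℕ.+-identityʳ p)) (sym e)) p≤i) ℕ.1+n≰n
last? {p}     (suc d) p≤i e = last d (ℕ.suc-injective (trans e (ℕ.+-suc p d)))

row-repeat : ∀ p d {i} A → p ≤ i → suc i ≡ p ℕ.+ d → τ i (row p d A) ≋ 𝟘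
row-repeat p d A p≤i e with last? d p≤i e
... | last d′ refl = τ-nilpotent (p ℕ.+ d′) (row p d′ A)

-- s_i commutes with the row down to s_{i+1} s_i, where the braid relation turns it into s_{i+1},
-- which commutes with the rest.
row-inside : ∀ p d {i} A → p ≤ i → suc i < p ℕ.+ d → τ i (row p d A) ≋ row p d (τ (suc i) A)
row-inside p zero    {i} A p≤i i< = contradiction (ℕ.<-trans (ℕ.n<1+n i) (subst (suc i <_) (ℕ.+-identityʳ p) i<)) (ℕ.≤⇒≯ p≤i)
row-inside p (suc d) {i} A p≤i i< with ℕ.m≤n⇒m<n∨m≡n (ℕ.≤-pred (subst (suc i <_) (ℕ.+-suc p d) i<))
... | inj₁ i<p+d = ≋-trans (τ-far i<p+d (row p d A)) (τ-cong (p ℕ.+ d) (row-inside p d A p≤i i<p+d))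
... | inj₂ e with last? d p≤i e
...   | last d′ refl rewrite ℕ.+-suc p d′ = ≋-trans (τ-braid i (row p d′ A))
  (τ-cong (suc i) (τ-cong i (row-above p d′ A (ℕ.n<1+n i))))

-- Two adjacent rows of equal length take p, p+1 to p+d, p+d+1, so s_{p+d} on their left becomes s_p
-- on their right. This is the case in which lengthening the first row would break monotonicity.
row-row : ∀ p d A → row p (suc d) (row (suc p) d A) ≋ row p d (row (suc p) d (τ p A))
row-row p zero    A = ≋-reflexive (cong (λ q → τ q A) (ℕ.+-identityʳ p))
row-row p (suc d) A rewrite ℕ.+-suc p d = begin
  τ (suc q) (τ q (row p d (τ (suc q) (row (suc p) d A))))  ≈⟨ τ-cong (suc q) (τ-cong q (row-above p d (row (suc p) d A) (ℕ.n<1+n q))) ⟨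
  τ (suc q) (τ q (τ (suc q) (row p d (row (suc p) d A))))  ≈⟨ τ-braid q (row p d (row (suc p) d A)) ⟨
  τ q (τ (suc q) (row p (suc d) (row (suc p) d A)))        ≈⟨ τ-cong q (τ-cong (suc q) (row-row p d A)) ⟩
  τ q (τ (suc q) (row p d (row (suc p) d (τ p A))))        ≈⟨ τ-cong q (row-above p d (row (suc p) d (τ p A)) (ℕ.n<1+n q)) ⟩
  row p (suc d) (row (suc p) (suc d) (τ p A))              ∎
  where
  open ≋-Reasoning
  q = p ℕ.+ d

rows : ℕ → List ℕ → Element → Element
rows p []       A = A
rows p (d ∷ ds) A = row p d (rows (suc p) ds A)

rows-cong : ∀ p ds {A B} → A ≋ B → rows p ds A ≋ rows p ds B
rows-cong p []       e = e
rows-cong p (d ∷ ds) e = row-cong p d (rows-cong (suc p) ds e)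

rows-below : ∀ p ds {i} A → suc i < p → τ i (rows p ds A) ≋ rows p ds (τ i A)
rows-below p []       A _ = ≋-refl
rows-below p (d ∷ ds) A q = ≋-trans (row-below p d (rows (suc p) ds A) q)
  (row-cong p d (rows-below (suc p) ds A (ℕ.m≤n⇒m≤1+n q)))

rows-⊙ : ∀ p ds {k} A → k < p → rows p ds (k ⊙ A) ≋ k ⊙ rows p ds A
rows-⊙ p []       A _ = ≋-refl
rows-⊙ p (d ∷ ds) A q = ≋-trans (row-cong p d (rows-⊙ (suc p) ds A (ℕ.m≤n⇒m≤1+n q)))
  (row-⊙ p d (rows (suc p) ds A) q)

-- For weakly increasing ds the word of rows 0 ds is that of the Grassmannian
-- permutation with values 0 + d₀ < 1 + d₁ < ⋯ at the first length ds places;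
-- these cases are those of left multiplication by s_i.
data LeftMultiple (p d₀ : ℕ) (ds : List ℕ) (i : ℕ) : Set where
  vanishes : (∀ A → τ i (rows p ds A) ≋ 𝟘) → LeftMultiple p d₀ ds i
  grows    : ∀ ds′ → Linked _≤_ (d₀ ∷ ds′) → length ds′ ≡ length ds →
    (∀ A → τ i (rows p ds A) ≋ rows p ds′ A) → LeftMultiple p d₀ ds i
  passes   : ∀ j → suc j ≢ p ℕ.+ length ds →
    (∀ A → τ i (rows p ds A) ≋ rows p ds (τ j A)) → LeftMultiple p d₀ ds i

LeftMultiple-row : ∀ {p d₀ i j} d ds → d₀ ≤ d → LeftMultiple (suc p) d ds j →
  (∀ A → τ i (row p d A) ≋ row p d (τ j A)) → LeftMultiple p d₀ (d ∷ ds) i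
LeftMultiple-row {p} d ds _ (vanishes h) f =
  vanishes λ A → ≋-trans (f _) (≋-trans (row-cong p d (h A)) (row-𝟘 p d))
LeftMultiple-row {p} d ds d₀≤d (grows ds′ inc len h) f =
  grows (d ∷ ds′) (d₀≤d ∷ inc) (cong suc len) λ A → ≋-trans (f _) (row-cong p d (h A))
LeftMultiple-row {p} d ds _ (passes k k≢ h) f =
  passes k (k≢ ∘ λ e → trans e (ℕ.+-suc p (length ds))) λ A → ≋-trans (f _) (row-cong p d (h A))

-- The letter is compared with the end of the first row. Beyond the end it commutes, at i = p + d it
-- can lengthen the row, at i = p + d - 1 it repeats the top letter, and lower down it comes out as
-- s_{i+1}. A letter leaving all k rows, starting from p = 0, is never s_{k-1}.
left-multiple : ∀ p {d₀} ds i → p ≤ i → Linked _≤_ (d₀ ∷ ds) → LeftMultiple p d₀ ds i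
left-multiple p [] i p≤i _ = passes i
  (λ e → ℕ.1+n≰n (subst (_≤ i) (trans (sym (ℕ.+-identityʳ p)) (sym e)) p≤i)) (λ _ → ≋-refl)
left-multiple p {d₀} (d ∷ ds) i p≤i (d₀≤d ∷ inc) with ℕ.<-cmp i (p ℕ.+ d)
... | tri> _ _ i> = LeftMultiple-row d ds d₀≤d (left-multiple (suc p) ds i (ℕ.≤-<-trans (ℕ.m≤m+n p d) i>) inc) λ A → row-above p d A i>
... | tri< i< _ _ with ℕ.m≤n⇒m<n∨m≡n i<
...   | inj₂ e   = vanishes λ A → row-repeat p d _ p≤i e
...   | inj₁ 1+i< = LeftMultiple-row d ds d₀≤d (left-multiple (suc p) ds (suc i) (s≤s p≤i) inc) λ A → row-inside p d A p≤i 1+i<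
left-multiple p {d₀} (d ∷ []) i p≤i (d₀≤d ∷ inc) | tri≈ _ refl _ = grows (suc d ∷ []) (ℕ.m≤n⇒m≤1+n d₀≤d ∷ [-]) refl λ A → ≋-refl
left-multiple p {d₀} (d ∷ e ∷ es) i p≤i (d₀≤d ∷ d≤e ∷ inc) | tri≈ _ refl _ with ℕ.m≤n⇒m<n∨m≡n d≤e
-- The row may grow only while the next one is strictly longer; at equality `row-row` expels s_p
-- instead, which commutes with all later rows.
... | inj₁ d<e  = grows (suc d ∷ e ∷ es) (ℕ.m≤n⇒m≤1+n d₀≤d ∷ d<e ∷ inc) refl λ A → ≋-refl
... | inj₂ refl = passes p (λ e → ℕ.m≢1+m+n p (ℕ.suc-injective (trans e (trans (ℕ.+-suc p _) (cong suc (ℕ.+-suc p _))))))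
  λ A → ≋-trans (row-row p d (rows (2 ℕ.+ p) es A))
    (row-cong p d (row-cong (suc p) d (rows-below (2 ℕ.+ p) es A ℕ.≤-refl)))

-- The parabolic factorization for the subgroup generated by all s_i with i ≠ k - 1: a minimal coset
-- representative on the left, and on the right a word `b` in the subgroup.
data NormalForm (k : ℕ) (a : List ℕ) : Set where
  vanishes : (∀ A → act a A ≋ 𝟘) → NormalForm k a
  factors  : ∀ ds b → Linked _≤_ (0 ∷ ds) → length ds ≡ k → All (λ i → suc i ≢ k) b →
    (∀ A → act a A ≋ rows 0 ds (act b A)) → NormalForm k a

normalForm : ∀ k a → NormalForm k a
normalForm k [] = factors (replicate k 0) [] (zeros k) (length-replicate k) [] (λ A → ≋-reflexive (sym (rows-zeros 0 k A)))
  where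
  zeros : ∀ k → Linked _≤_ (0 ∷ replicate k 0)
  zeros zero    = [-]
  zeros (suc k) = z≤n ∷ zeros k
  rows-zeros : ∀ p k A → rows p (replicate k 0) A ≡ A
  rows-zeros p zero    A = refl
  rows-zeros p (suc k) A = rows-zeros (suc p) k A
normalForm k (i ∷ a) with normalForm k a
... | vanishes h = vanishes λ A → ≋-trans (τ-cong i (h A)) (τ-𝟘 i)
... | factors ds b inc len b≢ h with left-multiple 0 ds i z≤n inc
...   | vanishes g           = vanishes λ A → ≋-trans (τ-cong i (h A)) (g (act b A))
...   | grows ds′ inc′ len′ g = factors ds′ b inc′ (trans len′ len) b≢ λ A → ≋-trans (τ-cong i (h A)) (g (act b A))
...   | passes j j≢ g        = factors ds (j ∷ b) inc len ((λ e → j≢ (trans e (sym len))) ∷ b≢) λ A → ≋-trans (τ-cong i (h A)) (g (act b A))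

block : ℕ → ℕ → Element → Element
block p zero    A = A
block p (suc k) A = p ⊙ block (suc p) k A

-- x_p ⋯ x_{p+k-1} contains both or neither of x_i, x_{i+1} under these conditions, so it is
-- symmetric in them.
τ-block : ∀ p k {i} A → suc i ≢ p → suc i ≢ p ℕ.+ k → τ i (block p k A) ≋ block p k (τ i A)
τ-block p zero    A _ _ = ≋-refl
τ-block p (suc k) {i} A i≢p i≢p+k with p ℕ.≟ i
... | no p≢i = ≋-trans (τ-⊙-other (block (suc p) k A) p≢i (i≢p ∘ sym))
  (⊙-cong p (τ-block (suc p) k A (p≢i ∘ sym ∘ ℕ.suc-injective) (i≢p+k ∘ λ e → trans e (sym (ℕ.+-suc p k)))))
τ-block p (suc zero)    A i≢p i≢p+k | yes refl = contradiction (ℕ.+-comm 1 p) i≢p+k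
τ-block p (suc (suc k)) A i≢p i≢p+k | yes refl = ≋-trans (τ-⊙-pair p (block (2 ℕ.+ p) k A))
  (⊙-cong p (⊙-cong (suc p) (τ-block (2 ℕ.+ p) k A (ℕ.<⇒≢ (ℕ.n<1+n (suc p))) (ℕ.<⇒≢ (s≤s (s≤s (ℕ.m≤m+n p k)))))))

act-block : ∀ k {a} A → All (λ i → suc i ≢ k) a → act a (block 0 k A) ≋ block 0 k (act a A)
act-block k A []       = ≋-refl
act-block k {i ∷ a} A (i≢ ∷ a≢) = ≋-trans (τ-cong i (act-block k A a≢)) (τ-block 0 k (act a A) (λ ()) i≢)

-- Positivity

-- The value at 1 is the one that gives ∂_u^w.
Positive : Element → Set
Positive A = HasNonNegativeCoefficients (⟦ A ⟧ 𝟙)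

Positive-resp-≋ : ∀ {A B} → A ≋ B → Positive A → Positive B
Positive-resp-≋ e A≥0 m = subst (0ℤ ℤ.≤_) (at e 𝟙 m) (A≥0 m)

Positive-⊕ : ∀ A B → Positive A → Positive B → Positive (A ⊕ B)
Positive-⊕ A B A≥0 B≥0 m = subst (0ℤ ℤ.≤_) (sym (coeff-⊕ A B 𝟙 m)) (ℤ.+-mono-≤ (A≥0 m) (B≥0 m))

Positive-const : ∀ {f} f-cong → 0ℤ ℤ.≤ f 𝟙 → Positive (const f f-cong)
Positive-const f-cong f≥0 []      = subst (0ℤ ℤ.≤_) (sym (ℤ.+-identityʳ _)) f≥0
Positive-const f-cong f≥0 (_ ∷ _) = ℤ.≤-refl

-- act a A evaluates to a positive polynomial for all words a which leave the
-- variables x_n, x_{n+1}, … alone.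
PositiveBelow : ℕ → Element → Set
PositiveBelow n A = ∀ {a} → All (λ i → suc i < n) a → Positive (act a A)

PositiveBelow-resp-≋ : ∀ {n A B} → A ≋ B → PositiveBelow n A → PositiveBelow n B
PositiveBelow-resp-≋ e h {a} a< = Positive-resp-≋ (act-cong a e) (h a<)

PositiveBelow-≤ : ∀ {m n A} → m ≤ n → PositiveBelow n A → PositiveBelow m A
PositiveBelow-≤ m≤n h a< = h (All.map (λ i< → ℕ.<-≤-trans i< m≤n) a<)

PositiveBelow-⊕ : ∀ {n A B} → PositiveBelow n A → PositiveBelow n B → PositiveBelow n (A ⊕ B)
PositiveBelow-⊕ {n} {A} {B} h g {a} a< = subst Positive (sym (act-⊕ a A B)) (Positive-⊕ (act a A) (act a B) (h a<) (g a<))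

PositiveBelow-τ : ∀ {n i A} → suc i < n → PositiveBelow n A → PositiveBelow n (τ i A)
PositiveBelow-τ {n} {i} {A} i<n h {a} a< = subst Positive (act-∷ʳ a i A) (h (All.++⁺ a< (i<n ∷ [])))

PositiveBelow-row : ∀ {n} p d {A} → p ℕ.+ d < n → PositiveBelow n A → PositiveBelow n (row p d A)
PositiveBelow-row p zero    _ h = h
PositiveBelow-row {n} p (suc d) {A} q h = PositiveBelow-τ {A = row p d A} (subst (_< n) (ℕ.+-suc p d) q)
  (PositiveBelow-row p d {A} (ℕ.<-trans (ℕ.+-monoʳ-< p (ℕ.n<1+n d)) q) h)

act-⊙ : ∀ {a k} A → All (λ i → suc i < k) a → act a (k ⊙ A) ≋ k ⊙ act a A
act-⊙ A []       = ≋-refl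
act-⊙ {i ∷ a} A (i< ∷ a<) = ≋-trans (τ-cong i (act-⊙ A a<))
  (τ-⊙-other (act a A) (ℕ.<⇒≢ (ℕ.<-trans (ℕ.n<1+n i) i<) ∘ sym) (ℕ.<⇒≢ i< ∘ sym))

-- s_{p+d-1} ⋯ s_p x_p = x_{p+d} s_{p+d-1} ⋯ s_p + Σ_j s_{p+d-1} ⋯ ŝ_j ⋯ s_p, one
-- s_j being omitted in each term of the sum.
PositiveBelow-row-⊙ : ∀ p d A → PositiveBelow (suc (p ℕ.+ d)) A → PositiveBelow (p ℕ.+ d) (row p d (p ⊙ A))
PositiveBelow-row-⊙ p zero A h {a} a< = Positive-resp-≋
  (≋-sym (act-⊙ A (subst (λ n → All (λ i → suc i < n) a) (ℕ.+-identityʳ p) a<)))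
  (◃-nonNegative p {⟦ act a A ⟧ 𝟙} (PositiveBelow-≤ {A = A} (ℕ.n≤1+n _) h a<))
PositiveBelow-row-⊙ p (suc d) A h = PositiveBelow-resp-≋ (≋-sym expand)
  (PositiveBelow-⊕ {p ℕ.+ suc d} {row (suc p) d A} {row (suc p) d (suc p ⊙ τ p A)}
    (PositiveBelow-≤ {A = row (suc p) d A} (ℕ.n≤1+n _)
      (PositiveBelow-row (suc p) d {A} (s≤s (ℕ.≤-reflexive (sym (ℕ.+-suc p d)))) h))
    (subst (λ n → PositiveBelow n (row (suc p) d (suc p ⊙ τ p A))) (sym (ℕ.+-suc p d))
      (PositiveBelow-row-⊙ (suc p) d (τ p A) (subst (λ n → PositiveBelow (suc n) (τ p A)) (ℕ.+-suc p d)
        (PositiveBelow-τ {A = A} (s≤s (ℕ.m<m+n p (s≤s z≤n))) h)))))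
  where
  expand : row p (suc d) (p ⊙ A) ≋ row (suc p) d A ⊕ row (suc p) d (suc p ⊙ τ p A)
  expand = ≋-trans (≋-reflexive (row-first p d (p ⊙ A)))
    (≋-trans (row-cong (suc p) d (τ-⊙-same p A)) (≋-reflexive (row-⊕ (suc p) d A (suc p ⊙ τ p A))))

-- The induction hypothesis for a product of blocks: moving one block past a word leaves
-- uncontrolled words acting on the remaining factors.
StablyPositive : Element → Set
StablyPositive A = ∀ a → Positive (act a A)

PositiveBelow-rows : ∀ p {d} ds A → Linked _≤_ (d ∷ ds) → StablyPositive A →
  PositiveBelow (p ℕ.+ d) (rows p ds (block p (length ds) A))
PositiveBelow-rows p []       A _           h {a} _ = h a
PositiveBelow-rows p (e ∷ es) A (d≤e ∷ inc) h = PositiveBelow-≤ {A = rows p (e ∷ es) (block p (suc (length es)) A)}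
  (ℕ.+-monoʳ-≤ p d≤e)
  (PositiveBelow-resp-≋ (row-cong p e (≋-sym (rows-⊙ (suc p) es (block (suc p) (length es) A) (ℕ.n<1+n p))))
    (PositiveBelow-row-⊙ p e _ (PositiveBelow-rows (suc p) es A inc h)))

act-++ : ∀ a b A → act (a ++ b) A ≡ act a (act b A)
act-++ a b A = foldr-++ τ A a b

StablyPositive-block : ∀ k {A} → StablyPositive A → StablyPositive (block 0 k A)
StablyPositive-block k {A} h a with normalForm k a
... | vanishes g = Positive-resp-≋ (≋-sym (g (block 0 k A))) (Positive-const {λ _ → 0ℤ} (λ _ _ _ → refl) ℤ.≤-refl)
... | factors ds b inc refl b≢ g = Positive-resp-≋
  (≋-sym (≋-trans (g (block 0 k A)) (rows-cong 0 ds (act-block k A b≢))))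
  -- `c` ranges over what is left of the rows; the bound 0 is harmless, as only the empty word
  -- remains on the left.
  (PositiveBelow-rows 0 ds (act b A) inc (λ c → subst Positive (act-++ c b A) (h (c ++ b))) [])

StablyPositive-const : ∀ {f} f-cong → (∀ v → 0ℤ ℤ.≤ f v) → StablyPositive (const f f-cong)
StablyPositive-const {f} f-cong f≥0 a with act-const a
  where
  act-const : ∀ a → ∃₂ λ g g-cong → act a (const f f-cong) ≡ const g g-cong × (∀ v → 0ℤ ℤ.≤ g v)
  act-const []      = f , f-cong , refl , f≥0
  act-const (i ∷ a) with act-const a
  ... | g , g-cong , e , g≥0 = raise i g , raise-cong i g-cong , cong (τ i) e , raise≥0
    where
    raise≥0 : ∀ v → 0ℤ ℤ.≤ raise i g v
    raise≥0 v with ascends v i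
    ... | true  = g≥0 (v ∙ s i)
    ... | false = ℤ.≤-refl
... | g , g-cong , e , g≥0 = subst Positive (sym e) (Positive-const g-cong (g≥0 𝟙))

-- The staircase monomial of w₀(n) as a product of blocks

block-upTo : ∀ k A → block 0 k A ≡ foldr _⊙_ A (upTo k)
block-upTo k A = go 0 k id (λ _ → refl)
  where
  go : ∀ p k (f : ℕ → ℕ) → (∀ j → f j ≡ p ℕ.+ j) → block p k A ≡ foldr _⊙_ A (applyUpTo f k)
  go p zero    f e = refl
  go p (suc k) f e = cong₂ _⊙_ (sym (trans (e 0) (ℕ.+-identityʳ p)))
    (go (suc p) k (f ∘ suc) (λ j → trans (e (suc j)) (ℕ.+-suc p j)))

⊙-resp-↭ : ∀ A {m n} → m ↭ n → foldr _⊙_ A m ≋ foldr _⊙_ A n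
⊙-resp-↭ A ↭.refl       = ≋-refl
⊙-resp-↭ A (prep k p)   = ⊙-cong k (⊙-resp-↭ A p)
⊙-resp-↭ A (swap {xs = m} j k p) = ≋-trans (⊙-comm j k (foldr _⊙_ A m)) (⊙-cong k (⊙-cong j (⊙-resp-↭ A p)))
⊙-resp-↭ A (↭.trans p q) = ≋-trans (⊙-resp-↭ A p) (⊙-resp-↭ A q)

staircase : ℕ → List ℕ → Monomial
staircase n = concatMap (λ i → replicate (n ∸ i) i)

staircase-suc : ∀ n l → All (_≤ n) l → staircase (suc n) l ↭ l ++ staircase n l
staircase-suc n []      []        = ↭-refl
staircase-suc n (i ∷ l) (i≤n ∷ l≤n) rewrite ℕ.+-∸-assoc 1 i≤n = prep i
  (↭-trans (++⁺ˡ (replicate (n ∸ i) i) (staircase-suc n l l≤n)) (shifts (replicate (n ∸ i) i) l))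

-- 𝔖_{w₀(n+1)} = x_0 ⋯ x_n 𝔖_{w₀(n)}: every exponent drops by one, and that of x_n becomes 0.
staircase-upTo-suc : ∀ n → staircase (suc n) (upTo (suc n)) ↭ upTo (suc n) ++ staircase n (upTo n)
staircase-upTo-suc n = ↭-trans (staircase-suc n (upTo (suc n)) (All.applyUpTo⁺₁ id (suc n) ℕ.≤-pred))
  (++⁺ˡ (upTo (suc n)) (↭-reflexive drop-last))
  where
  drop-last : staircase n (upTo (suc n)) ≡ staircase n (upTo n)
  drop-last = begin
    staircase n (upTo (suc n))                          ≡⟨ cong (staircase n) (upTo-∷ʳ n) ⟨
    staircase n (upTo n ∷ʳ n)                           ≡⟨ concatMap-++ _ (upTo n) (n ∷ []) ⟩
    staircase n (upTo n) ++ replicate (n ∸ n) n ++ []   ≡⟨ cong (λ k → staircase n (upTo n) ++ replicate k n ++ []) (ℕ.n∸n≡0 n) ⟩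
    staircase n (upTo n) ++ []                          ≡⟨ ++-identityʳ _ ⟩
    staircase n (upTo n)                                ∎
    where open ≡-Reasoning

StablyPositive-resp-≋ : ∀ {A B} → A ≋ B → StablyPositive A → StablyPositive B
StablyPositive-resp-≋ e h a = Positive-resp-≋ (act-cong a e) (h a)

StablyPositive-staircase : ∀ n {A} → StablyPositive A → StablyPositive (foldr _⊙_ A (staircase n (upTo n)))
StablyPositive-staircase zero        h = h
StablyPositive-staircase (suc n) {A} h = StablyPositive-resp-≋
  (≋-trans (≋-reflexive (trans (block-upTo (suc n) B) (sym (foldr-++ _⊙_ A (upTo (suc n)) _))))
    (≋-sym (⊙-resp-↭ A (staircase-upTo-suc n))))
  (StablyPositive-block (suc n) (StablyPositive-staircase n h))
  where
  B = foldr _⊙_ A (staircase n (upTo n))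

𝔖w₀-monomial : ∀ n → 𝔖w₀ n ≡ mono 1ℤ (staircase n (upTo n))
𝔖w₀-monomial n = product (upTo n)
  where
  power : ∀ i k → x i ^ₚ k ≡ mono 1ℤ (replicate k i)
  power i zero    = refl
  power i (suc k) = cong (x i *ₚ_) (power i k)
  product : ∀ l → foldr _*ₚ_ 1ₚ (map (λ i → x i ^ₚ (n ∸ i)) l) ≡ mono 1ℤ (staircase n l)
  product []      = refl
  product (i ∷ l) = cong₂ _*ₚ_ (power i (n ∸ i)) (product l)

StablyPositive-⊕ : ∀ A B → StablyPositive A → StablyPositive B → StablyPositive (A ⊕ B)
StablyPositive-⊕ A B h g a = subst Positive (sym (act-⊕ a A B)) (Positive-⊕ (act a A) (act a B) (h a) (g a))

StablyPositive-𝔖w₀ : ∀ n u → StablyPositive (𝔖w₀ n ⊗ u)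
StablyPositive-𝔖w₀ n u = subst (λ P → StablyPositive (P ⊗ u)) (sym (𝔖w₀-monomial n))
  (StablyPositive-⊕ (foldr _⊙_ (const f f-cong) (staircase n (upTo n))) 𝟘
    (StablyPositive-staircase n (StablyPositive-const f-cong f≥0))
    (StablyPositive-const {λ _ → 0ℤ} (λ _ _ _ → refl) (λ _ → ℤ.≤-refl)))
  where
  f : S∞ → ℤ
  f v = indicator u v * 1ℤ
  f-cong : ∀ v w → v ≈ w → f v ≡ f w
  f-cong v w v≈w = cong (_* 1ℤ) (indicator-cong u v w v≈w)
  f≥0 : ∀ v → 0ℤ ℤ.≤ f v
  f≥0 v with does (u ≈? v)
  ... | true  = ℤ.+≤+ z≤n
  ... | false = ℤ.≤-refl

theorem5p2 : ∀ (n : ℕ) → n ≥ 1 → ∀ (u w : S∞) (D : Poly → Poly) →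
    IsSkewDividedDifference u w D →
    HasNonNegativeCoefficients (u ⁻¹ ▷ D (𝔖w₀ n))
theorem5p2 n _ u w D δ m with derivation⇒reduced δ
-- By `coeff-▷`, each coefficient after renaming the variables is a coefficient of ∂_u^w(𝔖_{w₀(n)}).
... | a , r = subst (0ℤ ℤ.≤_)
  (sym (trans (coeff-▷ (u ⁻¹) (D (𝔖w₀ n)) m) (skew-as-action δ r (𝔖w₀ n) _)))
  (StablyPositive-𝔖w₀ n u a _)
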